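{- For every integer $k\ge 4$, every positive integer $n$ is a sum of $k$ nonzero generalized octagonal numbers, except for $n=1,2,\ldots,k-1$ and $n=k+b$ with $b\in\{1,2,3,5,6,9,10,13,17\}$.
   Context: A generalized octagonal number is a number of the form $P_8(x)=3x^2-2x$ with $x\in\mathbb{Z}$; it is nonzero iff $x\neq 0$. -}

module Defs where

open import Data.Nat using (ℕ; _+_; _≤_; _<_)
open import Data.Integer as ℤ using (ℤ; +_)
open import Data.Fin using (Fin)
open import Data.Vec using (Vec; foldr)
open import Data.Vec.Relation.Unary.All using (All)
open import Data.List using (List; _∷_; [])
open import Data.List.Membership.Propositional using (_∈_)
open import Data.Product using (Σ; ∃; _×_)
open import Data.Sum using (_⊎_)
open import Relation.Binary.PropositionalEquality using (_≡_; _≢_)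

P₈ : ℤ → ℤ
P₈ x = ℤ._-_ (ℤ._*_ (+ 3) (ℤ._*_ x x)) (ℤ._*_ (+ 2) x)

sumP₈ : ∀ {k} → Vec ℤ k → ℤ
sumP₈ = foldr _ (λ x acc → ℤ._+_ (P₈ x) acc) (+ 0)

-- n is a sum of k nonzero generalized octagonal numbers
-- (nonzero P₈(x) ⇔ x ≠ 0, per the paper's convention)
SumOfNonzeroOct : ℕ → ℕ → Set
SumOfNonzeroOct k n =
  Σ (Vec ℤ k) λ xs → All (λ x → P₈ x ≢ + 0) xs × sumP₈ xs ≡ + n

exceptionalOffsets : List ℕ
exceptionalOffsets = 1 ∷ 2 ∷ 3 ∷ 5 ∷ 6 ∷ 9 ∷ 10 ∷ 13 ∷ 17 ∷ []

Exceptional : ℕ → ℕ → Set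
Exceptional k n = (1 ≤ n × n < k) ⊎ ∃ λ b → b ∈ exceptionalOffsets × n ≡ k + b

{-# OPTIONS --safe #-}
module Submission where

-- Since P₈ 1 = 1, it suffices to represent 4 + b by four nonzero octagonal numbers. As
-- (1 - 3x)² = 3 P₈ x + 1, this means writing N = 3 (4 + b) + 4 as a sum of four squares prime to 3
-- and greater than 1. Lagrange's theorem gives four squares; if three of them are divisible by 3,
-- reflections in the vectors (1 , ±1 , ±1) make them prime to 3. If some xᵢ is zero, further such
-- reflections of (0 , b , c) remove it, unless (b , c) lies on one of 21 lines. Three pairs lying on
-- such lines determine the other coordinates, so only finitely many N remain.
-- Conversely, a nonzero octagonal number is 1 plus an element of the numerical semigroup ⟨4 , 7⟩,
-- whose gaps are exactly the exceptional offsets.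

open import Defs
open import Data.Bool using (if_then_else_)
open import Data.Empty using (⊥; ⊥-elim)
open import Data.Fin using (Fin; #_; toℕ; fromℕ<; splitAt; join)
import Data.Fin.Properties as Fin
open import Data.Integer as ℤ using (ℤ; +_; -[1+_]; -_; _+_; _*_; _-_; ∣_∣; +≤+)
open import Data.Integer.Divisibility using () renaming (_∣_ to _∣ℤ_)
open import Data.Integer.DivMod using (_%ℕ_; _/ℕ_; n%ℕd<d; a≡a%ℕn+[a/ℕn]*n)
import Data.Integer.Properties as ℤ
open import Data.Integer.Solver using (module +-*-Solver)
open import Data.Integer.Tactic.RingSolver using (solve-∀)
open import Data.List as List using (List; _∷_; []; length; map)
open import Data.List.Membership.Propositional using (_∈_; find)
open import Data.List.Membership.Propositional.Properties using (∈-map⁻)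
open import Data.List.Relation.Unary.All as All using (All; _∷_; [])
open import Data.List.Relation.Unary.Any as Any using (Any; any?; here; there)
open import Data.Nat as ℕ using (ℕ; zero; suc; _≤_; z≤n; s≤s)
open import Data.Nat.Divisibility using (_∣_; divides; _∣?_; ∣⇒≤)
open import Data.Nat.DivMod using (m%n<n)
open import Data.Nat.Induction using (<-rec)
open import Data.Nat.ListAction using (product)
open import Data.Nat.Primality using (Prime; prime⇒irreducible; euclidsLemma; ¬prime[1])
open import Data.Nat.Primality.Factorisation using (factorise; module PrimeFactorisation)
import Data.Nat.Properties as ℕ
open import Data.Product using (∃; _×_; _,_; proj₁; proj₂)
open import Data.Sum using (_⊎_; inj₁; inj₂; [_,_]′)
open import Data.Vec using (Vec; lookup; _∷_; [])
open import Data.Vec.Relation.Unary.All as VecAll using (_∷_; [])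
open import Function.Bundles using (_⇔_; mk⇔)
open import Relation.Binary.PropositionalEquality
open import Relation.Nullary using (¬_; Dec; yes; no; contradiction; ¬?; _×-dec_; _⊎-dec_)
open import Relation.Nullary.Decidable using (from-no; from-yes)
open +-*-Solver using (solve; Polynomial; con; var; ⟦_⟧; ⟦_⟧↓; prove; _:+_; _:*_; _:-_; :-_; _:=_)

-- Lagrange's four-square theorem

-- Modulo 3 a representation of N has one or four terms prime to 3. In the first case reflecting the
-- other three terms works unless all of them vanish, so the obstacle is N = w² with only one
-- nonzero term. There a second representation is needed: it comes from squaring a quaternion of
-- norm w, with induction on w when that square again has only one nonzero coordinate. The term 1
-- belongs to x = 0. Hence removing a zero means moving (1 , 1 - 3b , 1 - 3c) while keeping its
-- length and the coprimality to 3. The reflections that do this have denominator 3 or 9, so which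
-- of them is integral depends on residues: there are seven cases. Each new coordinate is an affine
-- function of b and c and vanishes on a line, whence 7 · 3 = 21 lines. A pair on such a line is no
-- contradiction, so other pairs are tried. When every pair fails, the lines form a linear system
-- whose determinant is never 0, and evaluation settles the finitely many solutions.

FourSquares : ℤ → Set
FourSquares n = ∃ λ a → ∃ λ b → ∃ λ c → ∃ λ d → a * a + b * b + c * c + d * d ≡ n

-- Multiplicativity of the quaternion norm: the terms on the left are the coordinates of β times the
-- conjugate of α, for α = a + bi + cj + dk and β = x + yi + zj + wk.
eulerFourSquare : ∀ a b c d x y z w →
  (a * x + b * y + c * z + d * w) * (a * x + b * y + c * z + d * w) +
  (a * y - b * x + c * w - d * z) * (a * y - b * x + c * w - d * z) +
  (a * z - b * w - c * x + d * y) * (a * z - b * w - c * x + d * y) +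
  (a * w + b * z - c * y - d * x) * (a * w + b * z - c * y - d * x) ≡
  (a * a + b * b + c * c + d * d) * (x * x + y * y + z * z + w * w)
eulerFourSquare = solve-∀

fourSquares-* : ∀ {m n} → FourSquares m → FourSquares n → FourSquares (m * n)
fourSquares-* (a , b , c , d , refl) (x , y , z , w , refl) =
  a * x + b * y + c * z + d * w , a * y - b * x + c * w - d * z ,
  a * z - b * w - c * x + d * y , a * w + b * z - c * y - d * x ,
  eulerFourSquare a b c d x y z w

-- Nonnegative sums and the descent step

square : ∀ {i j : ℤ} → i ≡ j → i * i ≡ j * j
square refl = refl

0≤+ : ∀ {i j} → + 0 ℤ.≤ i → + 0 ℤ.≤ j → + 0 ℤ.≤ i + j
0≤+ = ℤ.+-mono-≤

0≤* : ∀ {i j} → + 0 ℤ.≤ i → + 0 ℤ.≤ j → + 0 ℤ.≤ i * j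
0≤* {+ m} {+ n} _ _ = subst (+ 0 ℤ.≤_) (ℤ.pos-* m n) (+≤+ z≤n)

0≤i*i : ∀ i → + 0 ℤ.≤ i * i
0≤i*i (+ n)      = 0≤* {+ n} {+ n} (+≤+ z≤n) (+≤+ z≤n)
0≤i*i -[1+ n ]   = +≤+ z≤n

+≡0⇒≡0ˡ : ∀ {i j} → + 0 ℤ.≤ i → + 0 ℤ.≤ j → i + j ≡ + 0 → i ≡ + 0
+≡0⇒≡0ˡ {+ zero} {+ n} _ _ _ = refl

+≡0⇒≡0ʳ : ∀ {i j} → + 0 ℤ.≤ i → + 0 ℤ.≤ j → i + j ≡ + 0 → j ≡ + 0
+≡0⇒≡0ʳ {+ zero} {+ n} _ _ e = trans (sym (ℤ.+-identityˡ (+ n))) e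

allZero : ∀ {i j k l} → + 0 ℤ.≤ i → + 0 ℤ.≤ j → + 0 ℤ.≤ k → + 0 ℤ.≤ l →
  i + j + k + l ≡ + 0 → i ≡ + 0 × j ≡ + 0 × k ≡ + 0 × l ≡ + 0
allZero p q r s e = +≡0⇒≡0ˡ p q ij , +≡0⇒≡0ʳ p q ij , +≡0⇒≡0ʳ (0≤+ p q) r ijk , +≡0⇒≡0ʳ (0≤+ (0≤+ p q) r) s e
  where
  ijk = +≡0⇒≡0ˡ (0≤+ (0≤+ p q) r) s e
  ij  = +≡0⇒≡0ˡ (0≤+ p q) r ijk

i*i≡0⇒i≡0 : ∀ {i} → i * i ≡ + 0 → i ≡ + 0
i*i≡0⇒i≡0 {i} e with ℤ.i*j≡0⇒i≡0∨j≡0 i e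
... | inj₁ z = z
... | inj₂ z = z

-- A remainder of least absolute value. Squaring 2 |rem| ≤ m keeps the bound polynomial, so that
-- four such bounds can be added.
record Centred (m : ℕ) (a : ℤ) : Set where
  constructor centred
  field
    rem quo : ℤ
    split   : a ≡ rem + + m * quo
    bound   : + 0 ℤ.≤ + m * + m - + 4 * (rem * rem)

centredRem : ∀ m .{{_ : ℕ.NonZero m}} a → Centred m a
centredRem m a with + 2 * + (a %ℕ m) ℤ.≤? + m
... | yes 2r≤m = centred (+ r) q
        (trans (a≡a%ℕn+[a/ℕn]*n a m) (cong (λ s → + r + s) (ℤ.*-comm q (+ m))))
        (subst (+ 0 ℤ.≤_) (factor (+ m) (+ r))
          (0≤* (ℤ.i≤j⇒0≤j-i 2r≤m) (0≤+ {+ m} (+≤+ z≤n) (0≤* {+ 2} {+ r} (+≤+ z≤n) (+≤+ z≤n)))))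
  where
  r = a %ℕ m
  q = a /ℕ m
  factor : ∀ m r → (m - + 2 * r) * (m + + 2 * r) ≡ m * m - + 4 * (r * r)
  factor = solve-∀
... | no  2r≰m = centred (+ r - + m) (q + + 1)
        (trans (a≡a%ℕn+[a/ℕn]*n a m) (shift (+ r) q (+ m)))
        (subst (+ 0 ℤ.≤_) (factor (+ m) (+ r))
          (0≤* (0≤+ (0≤* {+ 2} (+≤+ z≤n) (ℤ.i≤j⇒0≤j-i (+≤+ (ℕ.<⇒≤ (n%ℕd<d a m))))) (+≤+ z≤n))
               (ℤ.i≤j⇒0≤j-i (ℤ.<⇒≤ (ℤ.≰⇒> 2r≰m)))))
  where
  r = a %ℕ m
  q = a /ℕ m
  shift : ∀ r q m → r + q * m ≡ (r - m) + m * (q + + 1)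
  shift = solve-∀
  factor : ∀ m r → (+ 2 * (m - r) + m) * (+ 2 * r - m) ≡ m * m - + 4 * ((r - m) * (r - m))
  factor = solve-∀

prime∤ : ∀ {p m} → Prime p → 1 ℕ.< m → m ℕ.< p → ∀ z → + p ≡ + m * z → ⊥
prime∤ {p} {m} pp 1<m m<p z e with prime⇒irreducible pp (divides ∣ z ∣ p≡)
  where
  p≡ : p ≡ ∣ z ∣ ℕ.* m
  p≡ = trans (cong ∣_∣ e) (trans (ℤ.abs-* (+ m) z) (ℕ.*-comm m ∣ z ∣))
... | inj₁ m≡1 = ℕ.<-irrefl (sym m≡1) 1<m
... | inj₂ m≡p = ℕ.<-irrefl m≡p m<p

-- The premise forces m = ±2b, hence 2bc = ±mc.
4b²≡m²⇒m∣2bc : ∀ m b c → m * m - + 4 * (b * b) ≡ + 0 → ∃ λ k → + 2 * (b * c) ≡ m * k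
4b²≡m²⇒m∣2bc m b c z = [ (λ d → c , plus d) , (λ d → - c , minus d) ]′
    (ℤ.i*j≡0⇒i≡0∨j≡0 (m - + 2 * b) (trans (sym (factor m b)) z))
  where
  open ≡-Reasoning
  factor : ∀ m b → m * m - + 4 * (b * b) ≡ (m - + 2 * b) * (m + + 2 * b)
  factor = solve-∀
  rewrite⁺ : ∀ m b c → + 2 * (b * c) ≡ m * c - (m - + 2 * b) * c
  rewrite⁺ = solve-∀
  rewrite⁻ : ∀ m b c → + 2 * (b * c) ≡ (m + + 2 * b) * c + m * - c
  rewrite⁻ = solve-∀
  plus : m - + 2 * b ≡ + 0 → + 2 * (b * c) ≡ m * c
  plus d = begin
    + 2 * (b * c)                ≡⟨ rewrite⁺ m b c ⟩
    m * c - (m - + 2 * b) * c    ≡⟨ cong (λ s → m * c - s * c) d ⟩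
    m * c - + 0 * c              ≡⟨ ℤ.+-identityʳ (m * c) ⟩
    m * c                        ∎
  minus : m + + 2 * b ≡ + 0 → + 2 * (b * c) ≡ m * - c
  minus d = begin
    + 2 * (b * c)                ≡⟨ rewrite⁻ m b c ⟩
    (m + + 2 * b) * c + m * - c  ≡⟨ cong (λ s → s * c + m * - c) d ⟩
    + 0 * c + m * - c            ≡⟨ ℤ.+-identityˡ (m * - c) ⟩
    m * - c                      ∎

strictlyBetween : ∀ {m} (P : ℤ → Set) r → + 0 ℤ.≤ r → r ℤ.≤ + m → r ≢ + 0 → r ≢ + m → P r →
  ∃ λ n → 1 ℕ.≤ n × n ℕ.< m × P (+ n)
strictlyBetween P (+ n) _ (+≤+ n≤m) n≢0 n≢m Pn =
  n , ℕ.n≢0⇒n>0 (λ e → n≢0 (cong +_ e)) , ℕ.≤∧≢⇒< n≤m (λ e → n≢m (cong +_ e)) , Pn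

module Descent
  {p : ℕ} (pp : Prime p) (m : ℕ) .{{_ : ℕ.NonZero m}} (1<m : 1 ℕ.< m) (m<p : m ℕ.< p)
  (a₁ a₂ a₃ a₄ : ℤ) (eq : a₁ * a₁ + a₂ * a₂ + a₃ * a₃ + a₄ * a₄ ≡ + m * + p)
  (q₁ : Centred m a₁) (q₂ : Centred m a₂) (q₃ : Centred m a₃) (q₄ : Centred m a₄)
  where

  open Centred q₁ renaming (rem to b₁; quo to c₁; split to split₁; bound to bound₁)
  open Centred q₂ renaming (rem to b₂; quo to c₂; split to split₂; bound to bound₂)
  open Centred q₃ renaming (rem to b₃; quo to c₃; split to split₃; bound to bound₃)
  open Centred q₄ renaming (rem to b₄; quo to c₄; split to split₄; bound to bound₄)

  bc = b₁ * c₁ + b₂ * c₂ + b₃ * c₃ + b₄ * c₄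
  cc = c₁ * c₁ + c₂ * c₂ + c₃ * c₃ + c₄ * c₄
  bb = b₁ * b₁ + b₂ * b₂ + b₃ * b₃ + b₄ * b₄

  -- The quotient of `bb` by `m`, found without division by expanding Σ (bᵢ + m cᵢ)² = m p.
  r : ℤ
  r = + p - + 2 * bc - + m * cc

  m*r≡bb : + m * r ≡ bb
  m*r≡bb = begin
    + m * (+ p - + 2 * bc - + m * cc)
      ≡⟨ expand (+ m) (+ p) bc cc ⟩
    + m * + p - + m * (+ 2 * bc + + m * cc)
      ≡⟨ cong (_- + m * (+ 2 * bc + + m * cc)) (sym eq) ⟩
    a₁ * a₁ + a₂ * a₂ + a₃ * a₃ + a₄ * a₄ - + m * (+ 2 * bc + + m * cc)
      ≡⟨ cong₂ (λ s t → s - t) (cong₂ _+_ (cong₂ _+_ (cong₂ _+_ (square split₁) (square split₂)) (square split₃)) (square split₄)) refl ⟩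
    _ ≡⟨ collect (+ m) b₁ b₂ b₃ b₄ c₁ c₂ c₃ c₄ ⟩
    bb ∎
    where
    open ≡-Reasoning
    expand : ∀ m p s t → m * (p - + 2 * s - m * t) ≡ m * p - m * (+ 2 * s + m * t)
    expand = solve-∀
    collect : ∀ m x y z w x′ y′ z′ w′ →
      (x + m * x′) * (x + m * x′) + (y + m * y′) * (y + m * y′) +
      (z + m * z′) * (z + m * z′) + (w + m * w′) * (w + m * w′) -
      m * (+ 2 * (x * x′ + y * y′ + z * z′ + w * w′) + m * (x′ * x′ + y′ * y′ + z′ * z′ + w′ * w′)) ≡
      x * x + y * y + z * z + w * w
    collect = solve-∀

  -- Let α = β + mγ be the quaternions of the aᵢ, bᵢ, cᵢ. The product of α and the conjugate of β
  -- has norm (m p)(m r) and equals m times r + γ β̄. The witnesses are the coordinates of r + γ β̄,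
  -- so the division by m is already carried out.
  r*p-fourSquares : FourSquares (r * + p)
  r*p-fourSquares =
    r + bc ,
    b₁ * c₂ - b₂ * c₁ + b₃ * c₄ - b₄ * c₃ ,
    b₁ * c₃ - b₂ * c₄ - b₃ * c₁ + b₄ * c₂ ,
    b₁ * c₄ + b₂ * c₃ - b₃ * c₂ - b₄ * c₁ , (begin
    _ ≡⟨ regroup r b₁ b₂ b₃ b₄ c₁ c₂ c₃ c₄ ⟩
    r * r + + 2 * r * bc + bb * cc
      ≡⟨ cong (λ s → r * r + + 2 * r * bc + s * cc) m*r≡bb ⟨
    r * r + + 2 * r * bc + + m * r * cc
      ≡⟨ finish (+ m) (+ p) bc cc ⟩
    r * + p ∎)
    where
    open ≡-Reasoning
    regroup : ∀ r x y z w x′ y′ z′ w′ →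
      (r + (x * x′ + y * y′ + z * z′ + w * w′)) * (r + (x * x′ + y * y′ + z * z′ + w * w′)) +
      (x * y′ - y * x′ + z * w′ - w * z′) * (x * y′ - y * x′ + z * w′ - w * z′) +
      (x * z′ - y * w′ - z * x′ + w * y′) * (x * z′ - y * w′ - z * x′ + w * y′) +
      (x * w′ + y * z′ - z * y′ - w * x′) * (x * w′ + y * z′ - z * y′ - w * x′) ≡
      r * r + + 2 * r * (x * x′ + y * y′ + z * z′ + w * w′) +
      (x * x + y * y + z * z + w * w) * (x′ * x′ + y′ * y′ + z′ * z′ + w′ * w′)
    regroup = solve-∀
    finish : ∀ m p s t → let r = p - + 2 * s - m * t in r * r + + 2 * r * s + m * r * t ≡ r * p
    finish = solve-∀

  instance
    m-pos : ℤ.Positive (+ m)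
    m-pos = ℤ.positive (ℤ.+<+ (ℕ.<-trans (s≤s z≤n) 1<m))

  0≤r : + 0 ℤ.≤ r
  0≤r = ℤ.*-cancelˡ-≤-pos (+ 0) r (+ m) (subst₂ ℤ._≤_ (sym (ℤ.*-zeroʳ (+ m))) (sym m*r≡bb)
    (0≤+ (0≤+ (0≤+ (0≤i*i b₁) (0≤i*i b₂)) (0≤i*i b₃)) (0≤i*i b₄)))

  -- The right side adds up the four nonnegative bounds. This yields r ≤ m, and r = m only if every
  -- bound is attained.
  slack : + m * (+ 4 * (+ m - r)) ≡
    (+ m * + m - + 4 * (b₁ * b₁)) + (+ m * + m - + 4 * (b₂ * b₂)) +
    (+ m * + m - + 4 * (b₃ * b₃)) + (+ m * + m - + 4 * (b₄ * b₄))
  slack = begin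
    + m * (+ 4 * (+ m - r))            ≡⟨ expand (+ m) r ⟩
    + 4 * (+ m * + m) - + 4 * (+ m * r) ≡⟨ cong (λ s → + 4 * (+ m * + m) - + 4 * s) m*r≡bb ⟩
    + 4 * (+ m * + m) - + 4 * bb        ≡⟨ spread (+ m) b₁ b₂ b₃ b₄ ⟩
    _ ∎
    where
    open ≡-Reasoning
    expand : ∀ m r → m * (+ 4 * (m - r)) ≡ + 4 * (m * m) - + 4 * (m * r)
    expand = solve-∀
    spread : ∀ m x y z w → + 4 * (m * m) - + 4 * (x * x + y * y + z * z + w * w) ≡
      (m * m - + 4 * (x * x)) + (m * m - + 4 * (y * y)) + (m * m - + 4 * (z * z)) + (m * m - + 4 * (w * w))
    spread = solve-∀

  r≤m : r ℤ.≤ + m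
  r≤m = ℤ.0≤i-j⇒j≤i (ℤ.*-cancelˡ-≤-pos (+ 0) (+ m - r) (+ 4)
    (ℤ.*-cancelˡ-≤-pos (+ 0) (+ 4 * (+ m - r)) (+ m)
      (subst₂ ℤ._≤_ (sym (ℤ.*-zeroʳ (+ m))) (sym slack) (0≤+ (0≤+ (0≤+ bound₁ bound₂) bound₃) bound₄))))

  recover : ∀ m p s t → p ≡ (p - + 2 * s - m * t) + + 2 * s + m * t
  recover = solve-∀

  -- If r = 0, then all bᵢ vanish and p = m · `cc`, against primality.
  r≢0 : r ≢ + 0
  r≢0 r≡0 = prime∤ pp 1<m m<p cc (begin
    + p                        ≡⟨ recover (+ m) (+ p) bc cc ⟩
    r + + 2 * bc + + m * cc    ≡⟨ cong₂ (λ s t → s + + 2 * t + + m * cc) r≡0 (bc≡0 b≡0) ⟩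
    + 0 + + m * cc             ≡⟨ ℤ.+-identityˡ (+ m * cc) ⟩
    + m * cc                   ∎)
    where
    open ≡-Reasoning
    b≡0 = allZero (0≤i*i b₁) (0≤i*i b₂) (0≤i*i b₃) (0≤i*i b₄)
      (trans (sym m*r≡bb) (trans (cong (λ s → + m * s) r≡0) (ℤ.*-zeroʳ (+ m))))
    times0 : ∀ {b} c → b * b ≡ + 0 → b * c ≡ + 0
    times0 {b} c z = trans (cong (_* c) (i*i≡0⇒i≡0 {b} z)) (ℤ.*-zeroˡ c)
    bc≡0 : b₁ * b₁ ≡ + 0 × b₂ * b₂ ≡ + 0 × b₃ * b₃ ≡ + 0 × b₄ * b₄ ≡ + 0 → bc ≡ + 0
    bc≡0 (z₁ , z₂ , z₃ , z₄) =
      cong₂ _+_ (cong₂ _+_ (cong₂ _+_ (times0 {b₁} c₁ z₁) (times0 {b₂} c₂ z₂)) (times0 {b₃} c₃ z₃)) (times0 {b₄} c₄ z₄)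

  -- If r = m then every bᵢ is ± m / 2, so m divides 2bᵢ and hence p.
  r≢m : r ≢ + m
  r≢m r≡m = divisible (allZero bound₁ bound₂ bound₃ bound₄
    (trans (sym slack) (trans (cong (λ s → + m * (+ 4 * (+ m - s))) r≡m)
      (trans (cong (λ s → + m * (+ 4 * s)) (ℤ.+-inverseʳ (+ m))) (ℤ.*-zeroʳ (+ m))))))
    where
    open ≡-Reasoning
    double : ∀ x y z w → + 2 * (x + y + z + w) ≡ + 2 * x + + 2 * y + + 2 * z + + 2 * w
    double = solve-∀
    collect : ∀ m x y z w t → m + (m * x + m * y + m * z + m * w) + m * t ≡ m * (+ 1 + (x + y + z + w) + t)
    collect = solve-∀
    finish : (∃ λ k → + 2 * (b₁ * c₁) ≡ + m * k) → (∃ λ k → + 2 * (b₂ * c₂) ≡ + m * k) →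
             (∃ λ k → + 2 * (b₃ * c₃) ≡ + m * k) → (∃ λ k → + 2 * (b₄ * c₄) ≡ + m * k) → ⊥
    finish (k₁ , e₁) (k₂ , e₂) (k₃ , e₃) (k₄ , e₄) = prime∤ pp 1<m m<p (+ 1 + (k₁ + k₂ + k₃ + k₄) + cc) (begin
      + p                        ≡⟨ recover (+ m) (+ p) bc cc ⟩
      r + + 2 * bc + + m * cc    ≡⟨ cong (λ s → s + + 2 * bc + + m * cc) r≡m ⟩
      + m + + 2 * bc + + m * cc  ≡⟨ cong (λ s → + m + s + + m * cc)
        (trans (double (b₁ * c₁) (b₂ * c₂) (b₃ * c₃) (b₄ * c₄)) (cong₂ _+_ (cong₂ _+_ (cong₂ _+_ e₁ e₂) e₃) e₄)) ⟩
      + m + (+ m * k₁ + + m * k₂ + + m * k₃ + + m * k₄) + + m * cc ≡⟨ collect (+ m) k₁ k₂ k₃ k₄ cc ⟩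
      + m * (+ 1 + (k₁ + k₂ + k₃ + k₄) + cc) ∎)
    divisible : + m * + m - + 4 * (b₁ * b₁) ≡ + 0 × + m * + m - + 4 * (b₂ * b₂) ≡ + 0 ×
      + m * + m - + 4 * (b₃ * b₃) ≡ + 0 × + m * + m - + 4 * (b₄ * b₄) ≡ + 0 → ⊥
    divisible (z₁ , z₂ , z₃ , z₄) = finish (4b²≡m²⇒m∣2bc (+ m) b₁ c₁ z₁) (4b²≡m²⇒m∣2bc (+ m) b₂ c₂ z₂) (4b²≡m²⇒m∣2bc (+ m) b₃ c₃ z₃) (4b²≡m²⇒m∣2bc (+ m) b₄ c₄ z₄)

  smaller : ∃ λ n → 1 ℕ.≤ n × n ℕ.< m × FourSquares (+ n * + p)
  smaller = strictlyBetween (λ s → FourSquares (s * + p)) r 0≤r r≤m r≢0 r≢m r*p-fourSquares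

descent : ∀ {p} → Prime p → ∀ m → 1 ℕ.≤ m → m ℕ.< p → FourSquares (+ m * + p) → FourSquares (+ p)
descent {p} pp = <-rec _ step
  where
  step : ∀ m → (∀ {n} → n ℕ.< m → 1 ℕ.≤ n → n ℕ.< p → FourSquares (+ n * + p) → FourSquares (+ p)) →
    1 ℕ.≤ m → m ℕ.< p → FourSquares (+ m * + p) → FourSquares (+ p)
  step 1 rec _ m<p f = subst FourSquares (ℤ.*-identityˡ (+ p)) f
  step m@(suc (suc _)) rec _ m<p (a₁ , a₂ , a₃ , a₄ , e) =
    continue (Descent.smaller pp m (s≤s (s≤s z≤n)) m<p a₁ a₂ a₃ a₄ e
      (centredRem m a₁) (centredRem m a₂) (centredRem m a₃) (centredRem m a₄))
    where
    continue : (∃ λ n → 1 ℕ.≤ n × n ℕ.< m × FourSquares (+ n * + p)) → FourSquares (+ p)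
    continue (n , 1≤n , n<m , f) = rec n<m 1≤n (ℕ.<-trans n<m m<p) f

-- Odd primes: a multiple of the form x² + y² + 1

%≡⇒∣- : ∀ a b p .{{_ : ℕ.NonZero p}} → a ℕ.% p ≡ b ℕ.% p → ∃ λ k → + a - + b ≡ k * + p
%≡⇒∣- a b p e = + (a ℕ./ p) - + (b ℕ./ p) , (begin
  + a - + b ≡⟨ cong₂ _-_ (a≡a%ℕn+[a/ℕn]*n (+ a) p) (a≡a%ℕn+[a/ℕn]*n (+ b) p) ⟩
  (+ (a ℕ.% p) + + (a ℕ./ p) * + p) - (+ (b ℕ.% p) + + (b ℕ./ p) * + p)
    ≡⟨ cong (λ s → (+ s + + (a ℕ./ p) * + p) - (+ (b ℕ.% p) + + (b ℕ./ p) * + p)) e ⟩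
  (+ (b ℕ.% p) + + (a ℕ./ p) * + p) - (+ (b ℕ.% p) + + (b ℕ./ p) * + p)
    ≡⟨ cancel (+ (b ℕ.% p)) (+ (a ℕ./ p)) (+ (b ℕ./ p)) (+ p) ⟩
  (+ (a ℕ./ p) - + (b ℕ./ p)) * + p ∎)
  where
  open ≡-Reasoning
  cancel : ∀ r s t p → (r + s * p) - (r + t * p) ≡ (s - t) * p
  cancel = solve-∀

module OddPrime (h : ℕ) (pp : Prime (suc (h ℕ.+ h))) where

  p = suc (h ℕ.+ h)

  1≤2h : 1 ℕ.≤ h ℕ.+ h
  1≤2h = ℕ.n≢0⇒n>0 (λ e → ¬prime[1] (subst (λ n → Prime (suc n)) e pp))

  ∣∧<⇒≡0 : ∀ {n} → p ∣ n → n ℕ.< p → n ≡ 0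
  ∣∧<⇒≡0 {zero}  _ _ = refl
  ∣∧<⇒≡0 {suc n} d l = contradiction (∣⇒≤ d) (ℕ.<⇒≱ l)

  -- The prime divides x - y or x + y. Both are at most 2h < p in absolute value, so one of them is
  -- 0; if it is x + y, then x = y = 0.
  squares-injective : ∀ x y → x ℕ.≤ h → y ℕ.≤ h → (k : ℤ) → + x * + x - + y * + y ≡ k * + p → x ≡ y
  squares-injective x y x≤h y≤h k e with euclidsLemma ∣ + x - + y ∣ (x ℕ.+ y) pp (divides ∣ k ∣ eq)
    where
    factor : ∀ x y → x * x - y * y ≡ (x - y) * (x + y)
    factor = solve-∀
    eq : ∣ + x - + y ∣ ℕ.* (x ℕ.+ y) ≡ ∣ k ∣ ℕ.* p
    eq = trans (sym (ℤ.abs-* (+ x - + y) (+ (x ℕ.+ y)))) (trans (cong ∣_∣ (trans (sym (factor (+ x) (+ y))) e)) (ℤ.abs-* k (+ p)))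
  ... | inj₁ d = ℤ.+-injective (ℤ.i-j≡0⇒i≡j (+ x) (+ y) (ℤ.∣i∣≡0⇒i≡0 (∣∧<⇒≡0 d
          (s≤s (ℕ.≤-trans (ℤ.∣i-j∣≤∣i∣+∣j∣ (+ x) (+ y)) (ℕ.+-mono-≤ x≤h y≤h))))))
  ... | inj₂ d = trans (ℕ.m+n≡0⇒m≡0 x x+y≡0) (sym (ℕ.m+n≡0⇒n≡0 x x+y≡0))
    where x+y≡0 = ∣∧<⇒≡0 d (s≤s (ℕ.+-mono-≤ x≤h y≤h))

  -- Modulo p, the values x² and -(y² + 1), the latter written as (p - 1) (y² + 1).
  value : Fin (suc h) ⊎ Fin (suc h) → ℕ
  value (inj₁ x) = toℕ x ℕ.* toℕ x
  value (inj₂ y) = (h ℕ.+ h) ℕ.* suc (toℕ y ℕ.* toℕ y)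

  pos-value₁ : ∀ x → + value (inj₁ x) ≡ + toℕ x * + toℕ x
  pos-value₁ x = ℤ.pos-* (toℕ x) (toℕ x)

  pos-value₂ : ∀ y → + value (inj₂ y) ≡ (+ p - + 1) * (+ 1 + + toℕ y * + toℕ y)
  pos-value₂ y = trans (ℤ.pos-* (h ℕ.+ h) (suc (toℕ y ℕ.* toℕ y))) (cong (λ s → + (h ℕ.+ h) * (+ 1 + s)) (ℤ.pos-* (toℕ y) (toℕ y)))

  toℕ≤h : (x : Fin (suc h)) → toℕ x ℕ.≤ h
  toℕ≤h x = ℕ.≤-pred (Fin.toℕ<n x)

  Hit : Set
  Hit = ∃ λ (x : Fin (suc h)) → ∃ λ (y : Fin (suc h)) → p ∣ suc (toℕ x ℕ.* toℕ x ℕ.+ toℕ y ℕ.* toℕ y)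

  mixed : ∀ x y (k : ℤ) → + value (inj₁ x) - + value (inj₂ y) ≡ k * + p → Hit
  mixed x y k e = x , y , divides ∣ k + (+ 1 + Y) ∣ (trans (cong ∣_∣ eq) (ℤ.abs-* (k + (+ 1 + Y)) (+ p)))
    where
    X = + toℕ x * + toℕ x
    Y = + toℕ y * + toℕ y
    rearrange : ∀ p X Y → + 1 + (X + Y) ≡ (X - (p - + 1) * (+ 1 + Y)) + (+ 1 + Y) * p
    rearrange = solve-∀
    eq : + suc (toℕ x ℕ.* toℕ x ℕ.+ toℕ y ℕ.* toℕ y) ≡ (k + (+ 1 + Y)) * + p
    eq = begin
      + 1 + (+ (toℕ x ℕ.* toℕ x) + + (toℕ y ℕ.* toℕ y)) ≡⟨ cong₂ (λ s t → + 1 + (s + t)) (ℤ.pos-* (toℕ x) (toℕ x)) (ℤ.pos-* (toℕ y) (toℕ y)) ⟩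
      + 1 + (X + Y) ≡⟨ rearrange (+ p) X Y ⟩
      (X - (+ p - + 1) * (+ 1 + Y)) + (+ 1 + Y) * + p ≡⟨ cong (_+ (+ 1 + Y) * + p) (trans (sym (cong₂ _-_ (pos-value₁ x) (pos-value₂ y))) e) ⟩
      k * + p + (+ 1 + Y) * + p ≡⟨ ℤ.*-distribʳ-+ (+ p) k (+ 1 + Y) ⟨
      (k + (+ 1 + Y)) * + p ∎
      where open ≡-Reasoning

  collision : ∀ s t → value s ℕ.% p ≡ value t ℕ.% p → s ≡ t ⊎ Hit
  collision s t e with %≡⇒∣- (value s) (value t) p e
  collision (inj₁ x) (inj₁ y) _ | k , e = inj₁ (cong inj₁ (Fin.toℕ-injective
    (squares-injective (toℕ x) (toℕ y) (toℕ≤h x) (toℕ≤h y) k (trans (sym (cong₂ _-_ (pos-value₁ x) (pos-value₁ y))) e))))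
  collision (inj₂ x) (inj₂ y) _ | k , e = inj₁ (cong inj₂ (Fin.toℕ-injective
    (squares-injective (toℕ x) (toℕ y) (toℕ≤h x) (toℕ≤h y) (X - Y - k) (begin
      X - Y ≡⟨ rearrange (+ p) X Y ⟩
      (X - Y) * + p - ((+ p - + 1) * (+ 1 + X) - (+ p - + 1) * (+ 1 + Y)) ≡⟨ cong (λ s → (X - Y) * + p - s) (trans (sym (cong₂ _-_ (pos-value₂ x) (pos-value₂ y))) e) ⟩
      (X - Y) * + p - k * + p ≡⟨ collect (X - Y) k (+ p) ⟩
      (X - Y - k) * + p ∎))))
    where
    open ≡-Reasoning
    X = + toℕ x * + toℕ x
    Y = + toℕ y * + toℕ y
    rearrange : ∀ p X Y → X - Y ≡ (X - Y) * p - ((p - + 1) * (+ 1 + X) - (p - + 1) * (+ 1 + Y))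
    rearrange = solve-∀
    collect : ∀ s k p → s * p - k * p ≡ (s - k) * p
    collect = solve-∀
  collision (inj₁ x) (inj₂ y) _ | k , e = inj₂ (mixed x y k e)
  collision (inj₂ y) (inj₁ x) _ | k , e = inj₂ (mixed x y (- k) (begin
    + value (inj₁ x) - + value (inj₂ y)       ≡⟨ swap (+ value (inj₁ x)) (+ value (inj₂ y)) ⟩
    - (+ value (inj₂ y) - + value (inj₁ x))   ≡⟨ cong -_ e ⟩
    - (k * + p)                               ≡⟨ ℤ.neg-distribˡ-* k (+ p) ⟩
    - k * + p                                 ∎))
    where
    open ≡-Reasoning
    swap : ∀ a b → a - b ≡ - (b - a)
    swap = solve-∀

  -- There are 2(h + 1) = p + 1 values and p residues. Distinct values of the same kind never
  -- collide, so some x² meets some -(y² + 1).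
  hit : Hit
  hit with Fin.pigeonhole {m = p} {n = suc h ℕ.+ suc h} (s≤s (ℕ.≤-reflexive (sym (ℕ.+-suc h h))))
             (λ i → fromℕ< (m%n<n (value (splitAt (suc h) i)) p))
  ... | i , j , i<j , e with collision (splitAt (suc h) i) (splitAt (suc h) j)
          (trans (sym (Fin.toℕ-fromℕ< (m%n<n (value (splitAt (suc h) i)) p)))
                 (trans (cong toℕ e) (Fin.toℕ-fromℕ< (m%n<n (value (splitAt (suc h) j)) p))))
  ... | inj₂ found = found
  ... | inj₁ same  = contradiction (cong toℕ i≡j) (ℕ.<⇒≢ i<j)
    where
    i≡j : i ≡ j
    i≡j = trans (sym (Fin.join-splitAt (suc h) (suc h) i))
                (trans (cong (join (suc h) (suc h)) same) (Fin.join-splitAt (suc h) (suc h) j))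

  fourSquares : FourSquares (+ p)
  fourSquares with hit
  ... | x , y , d@(divides m e) = descent pp m 1≤m m<p (+ toℕ x , + toℕ y , + 1 , + 0 , (begin
    X + Y + + 1 + + 0                    ≡⟨ reorder X Y ⟩
    + 1 + (X + Y)                        ≡⟨ cong₂ (λ s t → + 1 + (s + t)) (ℤ.pos-* (toℕ x) (toℕ x)) (ℤ.pos-* (toℕ y) (toℕ y)) ⟨
    + suc (toℕ x ℕ.* toℕ x ℕ.+ toℕ y ℕ.* toℕ y) ≡⟨ cong +_ e ⟩
    + (m ℕ.* p)                          ≡⟨ ℤ.pos-* m p ⟩
    + m * + p                            ∎))
    where
    open ≡-Reasoning
    X = + toℕ x * + toℕ x
    Y = + toℕ y * + toℕ y
    reorder : ∀ X Y → X + Y + + 1 + + 0 ≡ + 1 + (X + Y)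
    reorder = solve-∀
    1≤m : 1 ℕ.≤ m
    1≤m = ℕ.n≢0⇒n>0 (λ { refl → case-0 e })
      where
      case-0 : ∀ {n} → suc n ≡ 0 → ⊥
      case-0 ()
    -- From x, y ≤ h follows m p = x² + y² + 1 ≤ 2h² + 1 < p².
    m<p : m ℕ.< p
    m<p = ℕ.*-cancelʳ-< p m p (subst (ℕ._< p ℕ.* p) e (s≤s (ℕ.+-mono-≤ 1≤2h (ℕ.≤-trans
      (ℕ.+-mono-≤ (ℕ.*-mono-≤ (toℕ≤h x) (toℕ≤h x)) (ℕ.*-mono-≤ (toℕ≤h y) (toℕ≤h y)))
      (ℕ.≤-trans (ℕ.≤-reflexive (sym (ℕ.*-distribʳ-+ h h h)))
        (ℕ.*-monoʳ-≤ (h ℕ.+ h) (ℕ.≤-trans (ℕ.m≤m+n h h) (ℕ.n≤1+n _))))))))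

-- From primes to all natural numbers

half : ∀ n → ∃ λ h → n ≡ h ℕ.+ h ⊎ n ≡ suc (h ℕ.+ h)
half zero = 0 , inj₁ refl
half (suc n) with half n
... | h , inj₁ e = h , inj₂ (cong suc e)
... | h , inj₂ e = suc h , inj₁ (cong suc (trans e (sym (ℕ.+-suc h h))))

fourSquares-prime : ∀ p → Prime p → FourSquares (+ p)
fourSquares-prime p pp with half p
... | h , inj₂ refl = OddPrime.fourSquares h pp
... | h , inj₁ e with prime⇒irreducible pp (divides h (trans e (trans (cong (h ℕ.+_) (sym (ℕ.+-identityʳ h))) (ℕ.*-comm 2 h))))
... | inj₁ ()
... | inj₂ refl = + 1 , + 1 , + 0 , + 0 , refl

fourSquares-product : ∀ {ps} → All Prime ps → FourSquares (+ product ps)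
fourSquares-product []         = + 1 , + 0 , + 0 , + 0 , refl
fourSquares-product {p ∷ ps} (pp ∷ pps) =
  subst FourSquares (sym (ℤ.pos-* p (product ps))) (fourSquares-* (fourSquares-prime p pp) (fourSquares-product pps))

lagrange : ∀ n → FourSquares (+ n)
lagrange zero = + 0 , + 0 , + 0 , + 0 , refl
lagrange n@(suc _) = subst (λ k → FourSquares (+ k)) (sym (isFactorisation f)) (fourSquares-product (factorsPrime f))
  where
  open PrimeFactorisation
  f = factorise n

-- Sums of four squares prime to 3

data Mod3 : ℤ → Set where
  mod0 : ∀ k → Mod3 (+ 3 * k)
  mod1 : ∀ k → Mod3 (+ 3 * k + + 1)
  mod2 : ∀ k → Mod3 (+ 3 * k - + 1)

mod3 : ∀ i → Mod3 i
mod3 i with i %ℕ 3 | i /ℕ 3 | n%ℕd<d i 3 | a≡a%ℕn+[a/ℕn]*n i 3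
... | 0 | k | _ | refl = subst Mod3 (identity k) (mod0 k)
  where
  identity : ∀ k → + 3 * k ≡ + 0 + k * + 3
  identity = solve-∀
... | 1 | k | _ | refl = subst Mod3 (identity k) (mod1 k)
  where
  identity : ∀ k → + 3 * k + + 1 ≡ + 1 + k * + 3
  identity = solve-∀
... | 2 | k | _ | refl = subst Mod3 (identity k) (mod2 (k + + 1))
  where
  identity : ∀ k → + 3 * (k + + 1) - + 1 ≡ + 2 + k * + 3
  identity = solve-∀
... | suc (suc (suc _)) | _ | s≤s (s≤s (s≤s ())) | _

3∤ : ∀ {n} → ¬ 3 ∣ n → ∀ z → ∣ + 3 * z ∣ ≢ n
3∤ 3∤n z e = 3∤n (divides ∣ z ∣ (trans (sym e) (trans (ℤ.abs-* (+ 3) z) (ℕ.*-comm 3 ∣ z ∣))))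

3x+r≢3y+1 : ∀ x y r → ¬ 3 ∣ ∣ r - + 1 ∣ → + 3 * x + r ≢ + 3 * y + + 1
3x+r≢3y+1 x y r 3∤r e = 3∤ 3∤r (y - x) (cong ∣_∣ (begin
  + 3 * (y - x)                           ≡⟨ expand x y ⟩
  (+ 3 * y + + 1) - + 3 * x - + 1         ≡⟨ cong (λ s → s - + 3 * x - + 1) e ⟨
  (+ 3 * x + r) - + 3 * x - + 1           ≡⟨ cancel x r ⟩
  r - + 1                                 ∎))
  where
  open ≡-Reasoning
  expand : ∀ x y → + 3 * (y - x) ≡ (+ 3 * y + + 1) - + 3 * x - + 1
  expand = solve-∀
  cancel : ∀ x r → (+ 3 * x + r) - + 3 * x - + 1 ≡ r - + 1
  cancel = solve-∀

-- Of each pair ±y prime to 3 exactly one has the form 1 - 3x, so the values of `σ` are precisely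
-- the squares prime to 3.
σ : ℤ → ℤ
σ x = (+ 1 - + 3 * x) * (+ 1 - + 3 * x)

:σ : ∀ {n} → Polynomial n → Polynomial n
:σ x = (con (+ 1) :- con (+ 3) :* x) :* (con (+ 1) :- con (+ 3) :* x)

:P₈ : ∀ {n} → Polynomial n → Polynomial n
:P₈ x = con (+ 3) :* (x :* x) :- con (+ 2) :* x

data SquareMod3 (a : ℤ) : Set where
  divisible : ∀ k → a ≡ + 3 * k → SquareMod3 a
  coprime   : ∀ x → a * a ≡ σ x → SquareMod3 a

squareMod3 : ∀ a → SquareMod3 a
squareMod3 a with mod3 a
... | mod0 k = divisible k refl
... | mod1 k = coprime (- k) (solve 1 (λ k → let a = con (+ 3) :* k :+ con (+ 1) in a :* a := :σ (:- k)) refl k)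
... | mod2 k = coprime k (solve 1 (λ k → let a = con (+ 3) :* k :- con (+ 1) in a :* a := :σ k) refl k)

σ-* : ∀ x y → σ (x + y - + 3 * x * y) ≡ σ x * σ y
σ-* = solve 2 (λ x y → :σ (x :+ y :- con (+ 3) :* x :* y) := :σ x :* :σ y) refl

Sum₃σ : ℤ → Set
Sum₃σ n = ∃ λ x → ∃ λ y → ∃ λ z → σ x + σ y + σ z ≡ n

Sum₄σ : ℤ → Set
Sum₄σ n = ∃ λ x → ∃ λ y → ∃ λ z → ∃ λ w → σ x + σ y + σ z + σ w ≡ n

-- The reflection (a , b , c) ↦ 3 (a , b , c) - 2 (a + b + c) (1 , 1 , 1) triples lengths.
reflect : ∀ a b c k → a + b + c ≡ + 3 * k + + 1 → Sum₃σ (+ 9 * (a * a + b * b + c * c))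
-- The reflected coordinate 3a - 2(3k + 1) equals 1 - 3(2k + 1 - a). Eliminating `c` by means of `e`
-- leaves a ring identity in a, b, k.
reflect a b c k e = + 2 * k + + 1 - a , + 2 * k + + 1 - b , + 2 * k + + 1 - c ,
  subst (λ c → σ (+ 2 * k + + 1 - a) + σ (+ 2 * k + + 1 - b) + σ (+ 2 * k + + 1 - c) ≡ + 9 * (a * a + b * b + c * c))
    (trans (cong (_- (a + b)) (sym e)) (cancel a b c)) (identity a b k)
  where
  cancel : ∀ a b c → a + b + c - (a + b) ≡ c
  cancel = solve-∀
  identity : ∀ a b k → let c = + 3 * k + + 1 - (a + b) in
    σ (+ 2 * k + + 1 - a) + σ (+ 2 * k + + 1 - b) + σ (+ 2 * k + + 1 - c) ≡ + 9 * (a * a + b * b + c * c)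
  identity = solve 3 (λ a b k → let c = con (+ 3) :* k :+ con (+ 1) :- (a :+ b) ; d = con (+ 2) :* k :+ con (+ 1) in
    :σ (d :- a) :+ :σ (d :- b) :+ :σ (d :- c) := con (+ 9) :* (a :* a :+ b :* b :+ c :* c)) refl

-- Signs are chosen so that the sum of the three terms is 1 modulo 3.
sum₃σ-one : ∀ x b c → Sum₃σ (+ 9 * (σ x + + 3 * b * (+ 3 * b) + + 3 * c * (+ 3 * c)))
sum₃σ-one x b c = reflect (+ 1 - + 3 * x) (+ 3 * b) (+ 3 * c) (b + c - x) (identity x b c)
  where
  identity : ∀ x b c → (+ 1 - + 3 * x) + + 3 * b + + 3 * c ≡ + 3 * (b + c - x) + + 1
  identity = solve-∀

sum₃σ-two : ∀ x y c → Sum₃σ (+ 9 * (σ x + σ y + + 3 * c * (+ 3 * c)))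
sum₃σ-two x y c = subst Sum₃σ (squares x y c)
  (reflect (+ 3 * x - + 1) (+ 3 * y - + 1) (+ 3 * c) (x + y + c - + 1) (identity x y c))
  where
  identity : ∀ x y c → (+ 3 * x - + 1) + (+ 3 * y - + 1) + + 3 * c ≡ + 3 * (x + y + c - + 1) + + 1
  identity = solve-∀
  squares : ∀ x y c → + 9 * ((+ 3 * x - + 1) * (+ 3 * x - + 1) + (+ 3 * y - + 1) * (+ 3 * y - + 1) + + 3 * c * (+ 3 * c)) ≡
    + 9 * (σ x + σ y + + 3 * c * (+ 3 * c))
  squares = solve 3 (λ x y c → let x′ = con (+ 3) :* x :- con (+ 1) ; y′ = con (+ 3) :* y :- con (+ 1) ; c′ = con (+ 3) :* c in
    con (+ 9) :* (x′ :* x′ :+ y′ :* y′ :+ c′ :* c′) := con (+ 9) :* (:σ x :+ :σ y :+ c′ :* c′)) refl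

sum₃σ-three : ∀ x y z → Sum₃σ (+ 9 * (σ x + σ y + σ z))
sum₃σ-three x y z = subst Sum₃σ (squares x y z)
  (reflect (+ 1 - + 3 * x) (+ 1 - + 3 * y) (+ 3 * z - + 1) (z - x - y) (identity x y z))
  where
  identity : ∀ x y z → (+ 1 - + 3 * x) + (+ 1 - + 3 * y) + (+ 3 * z - + 1) ≡ + 3 * (z - x - y) + + 1
  identity = solve-∀
  squares : ∀ x y z → + 9 * (σ x + σ y + (+ 3 * z - + 1) * (+ 3 * z - + 1)) ≡ + 9 * (σ x + σ y + σ z)
  squares = solve 3 (λ x y z → let z′ = con (+ 3) :* z :- con (+ 1) in
    con (+ 9) :* (:σ x :+ :σ y :+ z′ :* z′) := con (+ 9) :* (:σ x :+ :σ y :+ :σ z)) refl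

sum₃σ-cong : ∀ {p p′ q q′ r r′} → p ≡ p′ → q ≡ q′ → r ≡ r′ →
  Sum₃σ (+ 9 * (p + q + r)) → Sum₃σ (+ 9 * (p′ + q′ + r′))
sum₃σ-cong refl refl refl s = s

-- Here `n` bounds the recursion. If some coordinate is prime to 3, one reflection suffices. If all
-- are divisible by 3, the recursive call on the thirds writes a² + b² + c² itself as three squares
-- prime to 3, and reflecting these supplies the factor 9.
sum₃σ-9 : ∀ n a b c → ∣ a ∣ ℕ.+ ∣ b ∣ ℕ.+ ∣ c ∣ ℕ.≤ n → ¬ (a ≡ + 0 × b ≡ + 0 × c ≡ + 0) →
  Sum₃σ (+ 9 * (a * a + b * b + c * c))
sum₃σ-9 zero a b c s≤0 ≢0 = ⊥-elim (≢0 (ℤ.∣i∣≡0⇒i≡0 (ℕ.m+n≡0⇒m≡0 ∣ a ∣ ab≡0) ,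
    ℤ.∣i∣≡0⇒i≡0 (ℕ.m+n≡0⇒n≡0 ∣ a ∣ ab≡0) , ℤ.∣i∣≡0⇒i≡0 (ℕ.m+n≡0⇒n≡0 (∣ a ∣ ℕ.+ ∣ b ∣) s≡0)))
  where
  s≡0  = ℕ.n≤0⇒n≡0 s≤0
  ab≡0 = ℕ.m+n≡0⇒m≡0 (∣ a ∣ ℕ.+ ∣ b ∣) s≡0
sum₃σ-9 (suc n) a b c s≤ ≢0 with squareMod3 a | squareMod3 b | squareMod3 c
... | coprime x ea | coprime y eb | coprime z ec = sum₃σ-cong (sym ea) (sym eb) (sym ec) (sum₃σ-three x y z)
... | coprime x ea | coprime y eb | divisible z ec = sum₃σ-cong (sym ea) (sym eb) (square (sym ec)) (sum₃σ-two x y z)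
... | coprime x ea | divisible y eb | coprime z ec = sum₃σ-cong (sym ea) (square (sym eb)) (sym ec)
  (subst (λ s → Sum₃σ (+ 9 * s)) (swap (σ x) (σ z) (+ 3 * y * (+ 3 * y))) (sum₃σ-two x z y))
  where
  swap : ∀ p q r → p + q + r ≡ p + r + q
  swap = solve-∀
... | divisible x ea | coprime y eb | coprime z ec = sum₃σ-cong (square (sym ea)) (sym eb) (sym ec)
  (subst (λ s → Sum₃σ (+ 9 * s)) (rotate (σ y) (σ z) (+ 3 * x * (+ 3 * x))) (sum₃σ-two y z x))
  where
  rotate : ∀ p q r → p + q + r ≡ r + p + q
  rotate = solve-∀
... | coprime x ea | divisible y eb | divisible z ec = sum₃σ-cong (sym ea) (square (sym eb)) (square (sym ec)) (sum₃σ-one x y z)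
... | divisible x ea | coprime y eb | divisible z ec = sum₃σ-cong (square (sym ea)) (sym eb) (square (sym ec))
  (subst (λ s → Sum₃σ (+ 9 * s)) (swap (σ y) (+ 3 * x * (+ 3 * x)) (+ 3 * z * (+ 3 * z))) (sum₃σ-one y x z))
  where
  swap : ∀ p q r → p + q + r ≡ q + p + r
  swap = solve-∀
... | divisible x ea | divisible y eb | coprime z ec = sum₃σ-cong (square (sym ea)) (square (sym eb)) (sym ec)
  (subst (λ s → Sum₃σ (+ 9 * s)) (rotate (σ z) (+ 3 * x * (+ 3 * x)) (+ 3 * y * (+ 3 * y))) (sum₃σ-one z x y))
  where
  rotate : ∀ p q r → p + q + r ≡ q + r + p
  rotate = solve-∀
... | divisible a′ refl | divisible b′ refl | divisible c′ refl =
  finish (sum₃σ-9 n a′ b′ c′ smaller (λ (p , q , r) → ≢0 (cong (λ s → + 3 * s) p , cong (λ s → + 3 * s) q , cong (λ s → + 3 * s) r)))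
  where
  third : ∀ s → 3 ℕ.* s ℕ.≤ suc n → s ℕ.≤ n
  third zero    _         = z≤n
  third (suc s) (s≤s 2+s) = ℕ.≤-trans (ℕ.≤-trans (ℕ.m≤m+n (suc s) _) (ℕ.m≤n+m _ s)) 2+s
  triple : ∀ s → ∣ + 3 * s ∣ ≡ 3 ℕ.* ∣ s ∣
  triple = ℤ.abs-* (+ 3)
  smaller : ∣ a′ ∣ ℕ.+ ∣ b′ ∣ ℕ.+ ∣ c′ ∣ ℕ.≤ n
  smaller = third _ (subst (ℕ._≤ suc n) (sym (trans (ℕ.*-distribˡ-+ 3 (∣ a′ ∣ ℕ.+ ∣ b′ ∣) ∣ c′ ∣)
    (cong₂ ℕ._+_ (trans (ℕ.*-distribˡ-+ 3 ∣ a′ ∣ ∣ b′ ∣) (sym (cong₂ ℕ._+_ (triple a′) (triple b′)))) (sym (triple c′))))) s≤)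
  pull : ∀ p q r → + 9 * (p * p + q * q + r * r) ≡ + 3 * p * (+ 3 * p) + + 3 * q * (+ 3 * q) + + 3 * r * (+ 3 * r)
  pull = solve-∀
  finish : Sum₃σ (+ 9 * (a′ * a′ + b′ * b′ + c′ * c′)) → _
  finish (x , y , z , e) = subst (λ s → Sum₃σ (+ 9 * s)) (trans e (pull a′ b′ c′)) (sum₃σ-three x y z)

data Lone (a b c d : ℤ) : Set where
  lone₁ : b ≡ + 0 → c ≡ + 0 → d ≡ + 0 → Lone a b c d
  lone₂ : a ≡ + 0 → c ≡ + 0 → d ≡ + 0 → Lone a b c d
  lone₃ : a ≡ + 0 → b ≡ + 0 → d ≡ + 0 → Lone a b c d
  lone₄ : a ≡ + 0 → b ≡ + 0 → c ≡ + 0 → Lone a b c d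

allZero? : ∀ a b c → (a ≡ + 0 × b ≡ + 0 × c ≡ + 0) ⊎ ¬ (a ≡ + 0 × b ≡ + 0 × c ≡ + 0)
allZero? a b c with a ℤ.≟ + 0 | b ℤ.≟ + 0 | c ℤ.≟ + 0
... | yes p | yes q | yes r = inj₁ (p , q , r)
... | no ¬p | _     | _     = inj₂ λ (p , _ , _) → ¬p p
... | _     | no ¬q | _     = inj₂ λ (_ , q , _) → ¬q q
... | _     | _     | no ¬r = inj₂ λ (_ , _ , r) → ¬r r

coprime+3divisible : ∀ x b c d → (b ≡ + 0 × c ≡ + 0 × d ≡ + 0) ⊎
  Sum₄σ (σ x + (+ 3 * b * (+ 3 * b) + + 3 * c * (+ 3 * c) + + 3 * d * (+ 3 * d)))
coprime+3divisible x b c d = [ inj₁ , (λ ≢0 → inj₂ (append (sum₃σ-9 _ b c d ℕ.≤-refl ≢0))) ]′ (allZero? b c d)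
  where
  pull : ∀ p q r → + 9 * (p * p + q * q + r * r) ≡ + 3 * p * (+ 3 * p) + + 3 * q * (+ 3 * q) + + 3 * r * (+ 3 * r)
  pull = solve-∀
  assoc : ∀ p q r s → p + q + r + s ≡ p + (q + r + s)
  assoc = solve-∀
  append : Sum₃σ (+ 9 * (b * b + c * c + d * d)) → _
  append (y , z , w , e) = x , y , z , w , trans (assoc (σ x) (σ y) (σ z) (σ w)) (cong (λ s → σ x + s) (trans e (pull b c d)))

-- Squares prime to 3 are 1 modulo 3, so iterating this from 0 counts the terms prime to 3.
residue : ℤ → ∀ {a} → SquareMod3 a → ℤ
residue r (divisible _ _) = r
residue r (coprime _ _)   = r + + 1

square≡ : ∀ {a} (s : SquareMod3 a) → ∃ λ q → ∀ r → r + a * a ≡ + 3 * q + residue r s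
square≡ {a} (divisible k refl) = + 3 * k * k , λ r → identity r k
  where
  identity : ∀ r k → r + + 3 * k * (+ 3 * k) ≡ + 3 * (+ 3 * k * k) + r
  identity = solve-∀
square≡ {a} (coprime x e) = P₈ x , λ r → trans (cong (λ s → r + s) e)
  (solve 2 (λ r x → r :+ :σ x := con (+ 3) :* :P₈ x :+ (r :+ con (+ 1))) refl r x)

sumOfSquares≡ : ∀ {a b c d} (s : SquareMod3 a) (t : SquareMod3 b) (u : SquareMod3 c) (v : SquareMod3 d) →
  ∃ λ q → a * a + b * b + c * c + d * d ≡ + 3 * q + residue (residue (residue (residue (+ 0) s) t) u) v
sumOfSquares≡ {a} {b} {c} {d} s t u v
  with (p , e) ← square≡ s | (q , f) ← square≡ t | (r , g) ← square≡ u | (w , h) ← square≡ v =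
  p + q + r + w , (begin
    a * a + b * b + c * c + d * d
      ≡⟨ cong (λ i → i + b * b + c * c + d * d) (trans (sym (ℤ.+-identityˡ (a * a))) (e (+ 0))) ⟩
    + 3 * p + r₁ + b * b + c * c + d * d        ≡⟨ assoc₁ (+ 3 * p) r₁ (b * b) (c * c) (d * d) ⟩
    + 3 * p + (r₁ + b * b) + c * c + d * d      ≡⟨ cong (λ i → + 3 * p + i + c * c + d * d) (f r₁) ⟩
    + 3 * p + (+ 3 * q + r₂) + c * c + d * d    ≡⟨ assoc₂ (+ 3 * p) (+ 3 * q) r₂ (c * c) (d * d) ⟩
    + 3 * p + + 3 * q + (r₂ + c * c) + d * d    ≡⟨ cong (λ i → + 3 * p + + 3 * q + i + d * d) (g r₂) ⟩
    + 3 * p + + 3 * q + (+ 3 * r + r₃) + d * d  ≡⟨ assoc₃ (+ 3 * p) (+ 3 * q) (+ 3 * r) r₃ (d * d) ⟩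
    + 3 * p + + 3 * q + + 3 * r + (r₃ + d * d)  ≡⟨ cong (λ i → + 3 * p + + 3 * q + + 3 * r + i) (h r₃) ⟩
    + 3 * p + + 3 * q + + 3 * r + (+ 3 * w + r₄) ≡⟨ collect p q r w r₄ ⟩
    + 3 * (p + q + r + w) + r₄                  ∎)
  where
  open ≡-Reasoning
  r₁ = residue (+ 0) s
  r₂ = residue r₁ t
  r₃ = residue r₂ u
  r₄ = residue r₃ v
  assoc₁ : ∀ p i j k l → p + i + j + k + l ≡ p + (i + j) + k + l
  assoc₁ = solve-∀
  assoc₂ : ∀ p q i j k → p + (q + i) + j + k ≡ p + q + (i + j) + k
  assoc₂ = solve-∀
  assoc₃ : ∀ p q r i j → p + q + (r + i) + j ≡ p + q + r + (i + j)
  assoc₃ = solve-∀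
  collect : ∀ p q r w i → + 3 * p + + 3 * q + + 3 * r + (+ 3 * w + i) ≡ + 3 * (p + q + r + w) + i
  collect = solve-∀

wrongResidue : ∀ {a b c d m} (s : SquareMod3 a) (t : SquareMod3 b) (u : SquareMod3 c) (v : SquareMod3 d) →
  ¬ 3 ∣ ∣ residue (residue (residue (residue (+ 0) s) t) u) v - + 1 ∣ →
  a * a + b * b + c * c + d * d ≢ + 3 * m + + 1
wrongResidue {m = m} s t u v 3∤ e =
  3x+r≢3y+1 (proj₁ (sumOfSquares≡ s t u v)) m (residue (residue (residue (residue (+ 0) s) t) u) v) 3∤ (trans (sym (proj₂ (sumOfSquares≡ s t u v))) e)

-- Modulo 3, either one or all four of the squares are prime to 3.
fourSquares⇒sum₄σ : ∀ a b c d m → a * a + b * b + c * c + d * d ≡ + 3 * m + + 1 →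
  Sum₄σ (a * a + b * b + c * c + d * d) ⊎ Lone a b c d
fourSquares⇒sum₄σ a b c d m eq with squareMod3 a | squareMod3 b | squareMod3 c | squareMod3 d
... | coprime x e | coprime y f | coprime z g | coprime w h =
  inj₁ (x , y , z , w , sym (cong₂ _+_ (cong₂ _+_ (cong₂ _+_ e f) g) h))
... | coprime x e | divisible b′ refl | divisible c′ refl | divisible d′ refl =
  [ (λ (p , q , r) → inj₂ (lone₁ (cong (λ s → + 3 * s) p) (cong (λ s → + 3 * s) q) (cong (λ s → + 3 * s) r)))
  , (λ s → inj₁ (subst Sum₄σ (trans (move (σ x) (+ 3 * b′ * (+ 3 * b′)) (+ 3 * c′ * (+ 3 * c′)) (+ 3 * d′ * (+ 3 * d′)))
      (cong (λ s → s + + 3 * b′ * (+ 3 * b′) + + 3 * c′ * (+ 3 * c′) + + 3 * d′ * (+ 3 * d′)) (sym e))) s)) ]′ (coprime+3divisible x b′ c′ d′)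
  where
  move : ∀ p q r s → p + (q + r + s) ≡ p + q + r + s
  move = solve-∀
... | divisible a′ refl | coprime x e | divisible c′ refl | divisible d′ refl =
  [ (λ (p , q , r) → inj₂ (lone₂ (cong (λ s → + 3 * s) p) (cong (λ s → + 3 * s) q) (cong (λ s → + 3 * s) r)))
  , (λ s → inj₁ (subst Sum₄σ (trans (move (σ x) (+ 3 * a′ * (+ 3 * a′)) (+ 3 * c′ * (+ 3 * c′)) (+ 3 * d′ * (+ 3 * d′)))
      (cong (λ s → + 3 * a′ * (+ 3 * a′) + s + + 3 * c′ * (+ 3 * c′) + + 3 * d′ * (+ 3 * d′)) (sym e))) s)) ]′ (coprime+3divisible x a′ c′ d′)
  where
  move : ∀ p q r s → p + (q + r + s) ≡ q + p + r + s
  move = solve-∀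
... | divisible a′ refl | divisible b′ refl | coprime x e | divisible d′ refl =
  [ (λ (p , q , r) → inj₂ (lone₃ (cong (λ s → + 3 * s) p) (cong (λ s → + 3 * s) q) (cong (λ s → + 3 * s) r)))
  , (λ s → inj₁ (subst Sum₄σ (trans (move (σ x) (+ 3 * a′ * (+ 3 * a′)) (+ 3 * b′ * (+ 3 * b′)) (+ 3 * d′ * (+ 3 * d′)))
      (cong (λ s → + 3 * a′ * (+ 3 * a′) + + 3 * b′ * (+ 3 * b′) + s + + 3 * d′ * (+ 3 * d′)) (sym e))) s)) ]′ (coprime+3divisible x a′ b′ d′)
  where
  move : ∀ p q r s → p + (q + r + s) ≡ q + r + p + s
  move = solve-∀
... | divisible a′ refl | divisible b′ refl | divisible c′ refl | coprime x e =
  [ (λ (p , q , r) → inj₂ (lone₄ (cong (λ s → + 3 * s) p) (cong (λ s → + 3 * s) q) (cong (λ s → + 3 * s) r)))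
  , (λ s → inj₁ (subst Sum₄σ (trans (move (σ x) (+ 3 * a′ * (+ 3 * a′)) (+ 3 * b′ * (+ 3 * b′)) (+ 3 * c′ * (+ 3 * c′)))
      (cong (λ s → + 3 * a′ * (+ 3 * a′) + + 3 * b′ * (+ 3 * b′) + + 3 * c′ * (+ 3 * c′) + s) (sym e))) s)) ]′ (coprime+3divisible x a′ b′ c′)
  where
  move : ∀ p q r s → p + (q + r + s) ≡ q + r + s + p
  move = solve-∀
-- The other eleven patterns have 0, 2 or 3 terms prime to 3; the literals 1 and 2 are the distance
-- of this count from 1.
... | s@(divisible _ _) | t@(divisible _ _) | u@(divisible _ _) | v@(divisible _ _) = ⊥-elim (wrongResidue {m = m} s t u v (from-no (3 ∣? 1)) eq)
... | s@(coprime _ _) | t@(coprime _ _) | u@(divisible _ _) | v@(divisible _ _) = ⊥-elim (wrongResidue {m = m} s t u v (from-no (3 ∣? 1)) eq)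
... | s@(coprime _ _) | t@(divisible _ _) | u@(coprime _ _) | v@(divisible _ _) = ⊥-elim (wrongResidue {m = m} s t u v (from-no (3 ∣? 1)) eq)
... | s@(coprime _ _) | t@(divisible _ _) | u@(divisible _ _) | v@(coprime _ _) = ⊥-elim (wrongResidue {m = m} s t u v (from-no (3 ∣? 1)) eq)
... | s@(divisible _ _) | t@(coprime _ _) | u@(coprime _ _) | v@(divisible _ _) = ⊥-elim (wrongResidue {m = m} s t u v (from-no (3 ∣? 1)) eq)
... | s@(divisible _ _) | t@(coprime _ _) | u@(divisible _ _) | v@(coprime _ _) = ⊥-elim (wrongResidue {m = m} s t u v (from-no (3 ∣? 1)) eq)
... | s@(divisible _ _) | t@(divisible _ _) | u@(coprime _ _) | v@(coprime _ _) = ⊥-elim (wrongResidue {m = m} s t u v (from-no (3 ∣? 1)) eq)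
... | s@(coprime _ _) | t@(coprime _ _) | u@(coprime _ _) | v@(divisible _ _) = ⊥-elim (wrongResidue {m = m} s t u v (from-no (3 ∣? 2)) eq)
... | s@(coprime _ _) | t@(coprime _ _) | u@(divisible _ _) | v@(coprime _ _) = ⊥-elim (wrongResidue {m = m} s t u v (from-no (3 ∣? 2)) eq)
... | s@(coprime _ _) | t@(divisible _ _) | u@(coprime _ _) | v@(coprime _ _) = ⊥-elim (wrongResidue {m = m} s t u v (from-no (3 ∣? 2)) eq)
... | s@(divisible _ _) | t@(coprime _ _) | u@(coprime _ _) | v@(coprime _ _) = ⊥-elim (wrongResidue {m = m} s t u v (from-no (3 ∣? 2)) eq)

-- Perfect squares congruent to 1 modulo 3

σ≡3P₈+1 : ∀ x → σ x ≡ + 3 * P₈ x + + 1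
σ≡3P₈+1 = solve 1 (λ x → :σ x := con (+ 3) :* :P₈ x :+ con (+ 1)) refl

[3k]²≢3m+1 : ∀ k m → + 3 * k * (+ 3 * k) ≢ + 3 * m + + 1
[3k]²≢3m+1 k m e = 3x+r≢3y+1 (+ 3 * k * k) m (+ 0) (from-no (3 ∣? 1)) (trans (identity k) e)
  where
  identity : ∀ k → + 3 * (+ 3 * k * k) + + 0 ≡ + 3 * k * (+ 3 * k)
  identity = solve-∀

i*i≡∣i∣*∣i∣ : ∀ i → i * i ≡ + ∣ i ∣ * + ∣ i ∣
i*i≡∣i∣*∣i∣ (+ n)    = refl
i*i≡∣i∣*∣i∣ -[1+ n ] = refl

-- The coordinates 2ab, 2ac, 2ad of a squared quaternion detect whether b, c, d vanish only if a ≠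
-- 0.
leadNonzero : ∀ {n} → n ≢ + 0 → FourSquares n →
  ∃ λ a → ∃ λ b → ∃ λ c → ∃ λ d → a ≢ + 0 × a * a + b * b + c * c + d * d ≡ n
leadNonzero n≢0 (a , b , c , d , e) with a ℤ.≟ + 0 | b ℤ.≟ + 0 | c ℤ.≟ + 0 | d ℤ.≟ + 0
... | no a≢0 | _ | _ | _ = a , b , c , d , a≢0 , e
... | yes _ | no b≢0 | _ | _ = b , a , c , d , b≢0 , trans (swap (b * b) (a * a) (c * c) (d * d)) e
  where
  swap : ∀ p q r s → p + q + r + s ≡ q + p + r + s
  swap = solve-∀
... | yes _ | yes _ | no c≢0 | _ = c , b , a , d , c≢0 , trans (swap (c * c) (b * b) (a * a) (d * d)) e
  where
  swap : ∀ p q r s → p + q + r + s ≡ r + q + p + s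
  swap = solve-∀
... | yes _ | yes _ | yes _ | no d≢0 = d , b , c , a , d≢0 , trans (swap (d * d) (b * b) (c * c) (a * a)) e
  where
  swap : ∀ p q r s → p + q + r + s ≡ s + q + r + p
  swap = solve-∀
... | yes refl | yes refl | yes refl | yes refl = contradiction (sym e) n≢0

sum₄σ-scale : ∀ s {n} → Sum₄σ n → Sum₄σ (σ s * n)
sum₄σ-scale s (x , y , z , w , refl) = mul x , mul y , mul z , mul w ,
  trans (cong₂ _+_ (cong₂ _+_ (cong₂ _+_ (σ-* s x) (σ-* s y)) (σ-* s z)) (σ-* s w))
        (distrib (σ s) (σ x) (σ y) (σ z) (σ w))
  where
  mul : ℤ → ℤ
  mul x = s + x - + 3 * s * x
  distrib : ∀ s p q r t → s * p + s * q + s * r + s * t ≡ s * (p + q + r + t)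
  distrib = solve-∀

-- Squaring the quaternion a + bi + cj + dk of norm w gives a representation of w² with at least
-- two nonzero terms, unless the quaternion is real (and w = a²) or its square has real part 0
-- (and w = 2a²).
module Square
  (w : ℕ) (2≤w : 2 ℕ.≤ w) (m : ℤ) (w²≡ : + w * + w ≡ + 3 * m + + 1)
  (rec : ∀ {u} → u ℕ.< w → 2 ℕ.≤ u → ∀ m → + u * + u ≡ + 3 * m + + 1 → Sum₄σ (+ u * + u))
  (a b c d : ℤ) (a≢0 : a ≢ + 0) (eq : a * a + b * b + c * c + d * d ≡ + w)
  where

  w≢3k : ∀ k → + w ≢ + 3 * k
  w≢3k k e = [3k]²≢3m+1 k m (trans (sym (square e)) w²≡)

  -- Here w = a² = u² with 2 ≤ u < w. The induction represents u², and its four terms are multiplied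
  -- by a² = w, which is prime to 3.
  real : b ≡ + 0 × c ≡ + 0 × d ≡ + 0 → Sum₄σ (+ w * + w)
  real (b≡0 , c≡0 , d≡0) = go (squareMod3 a)
    where
    w≡a² : + w ≡ a * a
    w≡a² = trans (sym eq) (trans (cong₂ _+_ (cong₂ _+_ (cong (λ s → a * a + s) (square b≡0)) (square c≡0)) (square d≡0)) (drop (a * a)))
      where
      drop : ∀ s → s + + 0 + + 0 + + 0 ≡ s
      drop = solve-∀
    u = ∣ a ∣
    w≡u² : w ≡ u ℕ.* u
    w≡u² = ℤ.+-injective (trans w≡a² (trans (i*i≡∣i∣*∣i∣ a) (sym (ℤ.pos-* u u))))
    2≤root : ∀ u → w ≡ u ℕ.* u → 2 ℕ.≤ u
    2≤root 0 e = ⊥-elim (ℕ.<⇒≱ 2≤w (subst (ℕ._≤ 1) (sym e) z≤n))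
    2≤root 1 e = ⊥-elim (ℕ.<⇒≱ 2≤w (ℕ.≤-reflexive e))
    2≤root (suc (suc u)) _ = s≤s (s≤s z≤n)
    root<w : ∀ u → w ≡ u ℕ.* u → 2 ℕ.≤ u → u ℕ.< w
    root<w (suc u) refl 2≤u = ℕ.m<m*n (suc u) (suc u) 2≤u
    go : SquareMod3 a → Sum₄σ (+ w * + w)
    go (divisible k a≡3k) = ⊥-elim (w≢3k (+ 3 * k * k) (trans w≡a² (trans (square a≡3k) (identity k))))
      where
      identity : ∀ k → + 3 * k * (+ 3 * k) ≡ + 3 * (+ 3 * k * k)
      identity = solve-∀
    go (coprime s a²≡σs) = subst Sum₄σ (cong₂ _*_ (sym w≡σs) (sym w≡+u²))
      (sum₄σ-scale s (rec (root<w u w≡u² 2≤u) 2≤u (P₈ s) (trans (sym w≡+u²) (trans w≡σs (σ≡3P₈+1 s)))))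
      where
      2≤u = 2≤root u w≡u²
      w≡σs : + w ≡ σ s
      w≡σs = trans w≡a² a²≡σs
      w≡+u² : + w ≡ + u * + u
      w≡+u² = trans w≡a² (i*i≡∣i∣*∣i∣ a)

  q : ℤ
  q = a * a - (b * b + c * c + d * d)

  -- From w = 2a² follows w² = 4a⁴, four equal squares of a², which is prime to 3 because w is.
  q≡0⇒sum₄σ : q ≡ + 0 → Sum₄σ (+ w * + w)
  q≡0⇒sum₄σ q≡0 = go (squareMod3 (a * a))
    where
    w≡2a² : + w ≡ a * a + a * a
    w≡2a² = trans (sym eq) (trans (identity (a * a) (b * b) (c * c) (d * d)) (trans (cong (λ s → a * a + a * a - s) q≡0) (ℤ.+-identityʳ (a * a + a * a))))
      where
      identity : ∀ p q r s → p + q + r + s ≡ p + p - (p - (q + r + s))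
      identity = solve-∀
    go : SquareMod3 (a * a) → Sum₄σ (+ w * + w)
    go (divisible k e) = ⊥-elim (w≢3k (+ 2 * k) (trans w≡2a² (trans (cong₂ _+_ e e) (identity k))))
      where
      identity : ∀ k → + 3 * k + + 3 * k ≡ + 3 * (+ 2 * k)
      identity = solve-∀
    go (coprime s e) = s , s , s , s , (begin
      σ s + σ s + σ s + σ s                                ≡⟨ cong (λ t → t + t + t + t) e ⟨
      a * a * (a * a) + a * a * (a * a) + a * a * (a * a) + a * a * (a * a)  ≡⟨ identity (a * a) ⟩
      (a * a + a * a) * (a * a + a * a)                    ≡⟨ square w≡2a² ⟨
      + w * + w                                            ∎)
      where
      open ≡-Reasoning
      identity : ∀ p → p * p + p * p + p * p + p * p ≡ (p + p) * (p + p)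
      identity = solve-∀

  quaternionSquare : q * q + + 2 * (a * b) * (+ 2 * (a * b)) + + 2 * (a * c) * (+ 2 * (a * c)) + + 2 * (a * d) * (+ 2 * (a * d)) ≡ + w * + w
  quaternionSquare = trans (identity a b c d) (square eq)
    where
    identity : ∀ a b c d → let q = a * a - (b * b + c * c + d * d) in
      q * q + + 2 * (a * b) * (+ 2 * (a * b)) + + 2 * (a * c) * (+ 2 * (a * c)) + + 2 * (a * d) * (+ 2 * (a * d)) ≡
      (a * a + b * b + c * c + d * d) * (a * a + b * b + c * c + d * d)
    identity = solve-∀

  2ai≡0⇒i≡0 : ∀ i → + 2 * (a * i) ≡ + 0 → i ≡ + 0
  2ai≡0⇒i≡0 i e = [ (λ ()) , (λ ai≡0 → [ (λ a≡0 → contradiction a≡0 a≢0) , (λ i≡0 → i≡0) ]′ (ℤ.i*j≡0⇒i≡0∨j≡0 a ai≡0)) ]′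
    (ℤ.i*j≡0⇒i≡0∨j≡0 (+ 2) e)

  result : Sum₄σ (+ w * + w)
  result = [ (λ s → subst Sum₄σ quaternionSquare s) , lone ]′
    (fourSquares⇒sum₄σ q (+ 2 * (a * b)) (+ 2 * (a * c)) (+ 2 * (a * d)) m (trans quaternionSquare w²≡))
    where
    lone : Lone q (+ 2 * (a * b)) (+ 2 * (a * c)) (+ 2 * (a * d)) → Sum₄σ (+ w * + w)
    lone (lone₁ p q r) = real (2ai≡0⇒i≡0 b p , 2ai≡0⇒i≡0 c q , 2ai≡0⇒i≡0 d r)
    lone (lone₂ q≡0 _ _) = q≡0⇒sum₄σ q≡0
    lone (lone₃ q≡0 _ _) = q≡0⇒sum₄σ q≡0
    lone (lone₄ q≡0 _ _) = q≡0⇒sum₄σ q≡0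

sum₄σ-square : ∀ w → 2 ℕ.≤ w → ∀ m → + w * + w ≡ + 3 * m + + 1 → Sum₄σ (+ w * + w)
sum₄σ-square = <-rec _ step
  where
  step : ∀ w → (∀ {u} → u ℕ.< w → 2 ℕ.≤ u → ∀ m → + u * + u ≡ + 3 * m + + 1 → Sum₄σ (+ u * + u)) →
    2 ℕ.≤ w → ∀ m → + w * + w ≡ + 3 * m + + 1 → Sum₄σ (+ w * + w)
  step w rec 2≤w m e = continue (leadNonzero w≢0 (lagrange w))
    where
    w≢0 : + w ≢ + 0
    w≢0 z = ℕ.<⇒≱ 2≤w (subst (ℕ._≤ 1) (sym (ℤ.+-injective z)) z≤n)
    continue : _ → _
    continue (a , b , c , d , a≢0 , eq) = Square.result w 2≤w m e rec a b c d a≢0 eq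

-- Four octagonal numbers, zeros allowed

fourOctagonals : ∀ n → ∃ λ x → ∃ λ y → ∃ λ z → ∃ λ w → P₈ x + P₈ y + P₈ z + P₈ w ≡ + n
fourOctagonals n = toOctagonals (fromSquares (lagrange N))
  where
  N = 4 ℕ.+ 3 ℕ.* n
  N≡ : + N ≡ + 3 * (+ n + + 1) + + 1
  N≡ = trans (cong (λ s → + 4 + s) (ℤ.pos-* 3 n)) (identity (+ n))
    where
    identity : ∀ n → + 4 + + 3 * n ≡ + 3 * (n + + 1) + + 1
    identity = solve-∀

  toOctagonals : Sum₄σ (+ N) → _
  toOctagonals (x , y , z , w , e) = x , y , z , w ,
    ℤ.*-cancelˡ-≡ (+ 3) (P₈ x + P₈ y + P₈ z + P₈ w) (+ n) (begin
      + 3 * (P₈ x + P₈ y + P₈ z + P₈ w)    ≡⟨ identity x y z w ⟩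
      σ x + σ y + σ z + σ w - + 4          ≡⟨ cong (_- + 4) e ⟩
      + N - + 4                            ≡⟨ cong (_- + 4) N≡ ⟩
      + 3 * (+ n + + 1) + + 1 - + 4        ≡⟨ cancel (+ n) ⟩
      + 3 * + n                            ∎)
    where
    open ≡-Reasoning
    identity : ∀ x y z w → + 3 * (P₈ x + P₈ y + P₈ z + P₈ w) ≡ σ x + σ y + σ z + σ w - + 4
    identity = solve 4 (λ x y z w → con (+ 3) :* (:P₈ x :+ :P₈ y :+ :P₈ z :+ :P₈ w) :=
      :σ x :+ :σ y :+ :σ z :+ :σ w :- con (+ 4)) refl
    cancel : ∀ n → + 3 * (n + + 1) + + 1 - + 4 ≡ + 3 * n
    cancel = solve-∀

  perfectSquare : ∀ v → v * v ≡ + N → Sum₄σ (+ N)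
  perfectSquare v e = subst Sum₄σ (sym N≡u²) (sum₄σ-square ∣ v ∣ (2≤u ∣ v ∣ (ℤ.+-injective (trans N≡u² (sym (ℤ.pos-* ∣ v ∣ ∣ v ∣)))))
    (+ n + + 1) (trans (sym N≡u²) N≡))
    where
    N≡u² : + N ≡ + ∣ v ∣ * + ∣ v ∣
    N≡u² = trans (sym e) (i*i≡∣i∣*∣i∣ v)
    2≤u : ∀ u → N ≡ u ℕ.* u → 2 ℕ.≤ u
    2≤u 0 ()
    2≤u 1 ()
    2≤u (suc (suc u)) _ = s≤s (s≤s z≤n)

  fromSquares : FourSquares (+ N) → Sum₄σ (+ N)
  fromSquares (a , b , c , d , e) = [ (λ s → subst Sum₄σ e s) , lone ]′ (fourSquares⇒sum₄σ a b c d (+ n + + 1) (trans e N≡))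
    where
    lone : Lone a b c d → Sum₄σ (+ N)
    lone (lone₁ refl refl refl) = perfectSquare a (trans (identity (a * a)) e)
      where
      identity : ∀ s → s ≡ s + + 0 + + 0 + + 0
      identity = solve-∀
    lone (lone₂ refl refl refl) = perfectSquare b (trans (identity (b * b)) e)
      where
      identity : ∀ s → s ≡ + 0 + s + + 0 + + 0
      identity = solve-∀
    lone (lone₃ refl refl refl) = perfectSquare c (trans (identity (c * c)) e)
      where
      identity : ∀ s → s ≡ + 0 + + 0 + s + + 0
      identity = solve-∀
    lone (lone₄ refl refl refl) = perfectSquare d (trans (identity (d * d)) e)
      where
      identity : ∀ s → s ≡ + 0 + + 0 + + 0 + s
      identity = solve-∀

-- Replacing a triple (0 , b , c) by one without zeros

-- The right side is the sum for (0 , b , c), since `P₈` vanishes at 0.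
Removable : ℤ → ℤ → Set
Removable b c = ∃ λ x → ∃ λ y → ∃ λ z → (x ≢ + 0 × y ≢ + 0 × z ≢ + 0) × P₈ x + P₈ y + P₈ z ≡ P₈ b + P₈ c

record Line : Set where
  constructor line
  field
    p q r : ℤ

_at_,_ : Line → ℤ → ℤ → ℤ
line p q r at b , c = p * b + q * c + r

-- The rows correspond to the seven cases of `bySumResidue`; the entries of a row are
-- 3 or 9 times the coordinates of the new triple, as functions of b and c.
badLines : Vec Line 21
badLines =
  line (+ 2) (+ 2) (+ 0) ∷ line (-[1+ 0 ]) (+ 2) (+ 0) ∷ line (+ 2) (-[1+ 0 ]) (+ 0) ∷
  line (-[1+ 1 ]) (-[1+ 1 ]) (+ 2) ∷ line (+ 1) (-[1+ 1 ]) (+ 2) ∷ line (-[1+ 1 ]) (+ 1) (+ 2) ∷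
  line (+ 4) (+ 4) (-[1+ 1 ]) ∷ line (+ 1) (-[1+ 7 ]) (+ 4) ∷ line (-[1+ 7 ]) (+ 1) (+ 4) ∷
  line (-[1+ 3 ]) (-[1+ 3 ]) (+ 8) ∷ line (-[1+ 0 ]) (+ 8) (+ 2) ∷ line (+ 8) (-[1+ 0 ]) (+ 2) ∷
  line (+ 8) (-[1+ 3 ]) (+ 2) ∷ line (-[1+ 0 ]) (-[1+ 3 ]) (+ 2) ∷ line (-[1+ 3 ]) (-[1+ 6 ]) (+ 8) ∷
  line (-[1+ 7 ]) (+ 4) (+ 4) ∷ line (+ 1) (+ 4) (+ 4) ∷ line (+ 4) (+ 7) (-[1+ 1 ]) ∷
  line (+ 4) (-[1+ 7 ]) (+ 4) ∷ line (+ 7) (+ 4) (-[1+ 1 ]) ∷ line (+ 4) (+ 1) (+ 4) ∷ []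

OnLine : ℤ → ℤ → Set
OnLine b c = ∃ λ i → lookup badLines i at b , c ≡ + 0

:line : ∀ {n} → Line → Polynomial n → Polynomial n → Polynomial n
:line (line p q r) b c = con p :* b :+ con q :* c :+ con r

-- The arguments are polynomial syntax, so that the four identities compare solver normal forms and
-- hold by `refl` at each use. Each chosen line evaluates to κ times a new coordinate; a vanishing
-- coordinate therefore puts (b , c) on that line.
replace : ∀ {n} (ρ : Vec ℤ n) (b c x y z : Polynomial n) (i j k : Fin 21) (κ : ℤ) →
  ⟦ :P₈ x :+ :P₈ y :+ :P₈ z ⟧↓ ρ ≡ ⟦ :P₈ b :+ :P₈ c ⟧↓ ρ →
  ⟦ :line (lookup badLines i) b c ⟧↓ ρ ≡ ⟦ con κ :* x ⟧↓ ρ →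
  ⟦ :line (lookup badLines j) b c ⟧↓ ρ ≡ ⟦ con κ :* y ⟧↓ ρ →
  ⟦ :line (lookup badLines k) b c ⟧↓ ρ ≡ ⟦ con κ :* z ⟧↓ ρ →
  Removable (⟦ b ⟧ ρ) (⟦ c ⟧ ρ) ⊎ OnLine (⟦ b ⟧ ρ) (⟦ c ⟧ ρ)
replace ρ b c x y z i j k κ sum≡ x≡ y≡ z≡ =
  classify (⟦ x ⟧ ρ ℤ.≟ + 0) (⟦ y ⟧ ρ ℤ.≟ + 0) (⟦ z ⟧ ρ ℤ.≟ + 0)
  where
  vanish : ∀ i x → ⟦ :line (lookup badLines i) b c ⟧↓ ρ ≡ ⟦ con κ :* x ⟧↓ ρ → ⟦ x ⟧ ρ ≡ + 0 →
    OnLine (⟦ b ⟧ ρ) (⟦ c ⟧ ρ)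
  vanish i x e x≡0 = i , trans (prove ρ (:line (lookup badLines i) b c) (con κ :* x) e)
                               (trans (cong (λ s → κ * s) x≡0) (ℤ.*-zeroʳ κ))
  classify : Dec (⟦ x ⟧ ρ ≡ + 0) → Dec (⟦ y ⟧ ρ ≡ + 0) → Dec (⟦ z ⟧ ρ ≡ + 0) →
    Removable (⟦ b ⟧ ρ) (⟦ c ⟧ ρ) ⊎ OnLine (⟦ b ⟧ ρ) (⟦ c ⟧ ρ)
  classify (yes x≡0) _         _         = inj₂ (vanish i x x≡ x≡0)
  classify (no _)    (yes y≡0) _         = inj₂ (vanish j y y≡ y≡0)
  classify (no _)    (no _)    (yes z≡0) = inj₂ (vanish k z z≡ z≡0)
  classify (no x≢0)  (no y≢0)  (no z≢0)  = inj₁ (⟦ x ⟧ ρ , ⟦ y ⟧ ρ , ⟦ z ⟧ ρ , (x≢0 , y≢0 , z≢0) ,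
    prove ρ (:P₈ x :+ :P₈ y :+ :P₈ z) (:P₈ b :+ :P₈ c) sum≡)

-- With yᵢ = 1 - 3xᵢ one has Σ yᵢ² = 3 Σ P₈ xᵢ + 3. Reflecting (1 , 1 - 3b , 1 - 3c) in the plane
-- orthogonal to (1 , 1 , 1) gives an integral triple; it is prime to 3 unless b + c ≡ 2 modulo 3,
-- and in that case a second reflection, in (1 , ±1 , ±1), restores this.
private
  v₀ v₁ : Polynomial 2
  v₀ = var (# 0)
  v₁ = var (# 1)

  ‵_ : ℕ → Polynomial 2
  ‵ n = con (+ n)

bySumResidue : ∀ b {t} → Mod3 t → Removable b (t - b) ⊎ OnLine b (t - b)
bySumResidue b (mod0 u) = replace (u ∷ b ∷ []) v₁ (‵ 3 :* v₀ :- v₁)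
  -- With t = b + c the reflected triple is (2t - 1 , 2t - 1 - 3b , 2t - 1 - 3c); up to sign its
  -- entries are 1 - 3x, 1 - 3y, 1 - 3z for the x, y, z given here.
  (‵ 2 :* v₀) (‵ 2 :* v₀ :- v₁) (v₁ :- v₀)
  (# 0) (# 1) (# 2) (+ 3) refl refl refl refl
bySumResidue b (mod1 u) = replace (u ∷ b ∷ []) v₁ (‵ 3 :* v₀ :+ ‵ 1 :- v₁)
  (:- (‵ 2 :* v₀)) (v₁ :- ‵ 2 :* v₀) (v₀ :- v₁ :+ ‵ 1)
  (# 3) (# 4) (# 5) (+ 3) refl refl refl refl
bySumResidue b (mod2 u) = byThird (mod3 u) (mod3 b)
  where
  -- A third of the reflected triple is (2u - 1 , 2u - 1 - b , b - u). Reflecting in (1 , 1 , 1)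
  -- would only lead back. The vector (-1 , 1 , 1) has inner product -u with it, which settles u
  -- prime to 3. If 3 divides u, then (1 , 1 , -1) gives b + 1 modulo 3 and serves b ≡ 0, 1, while
  -- (1 , -1 , 1) gives 2b and serves b ≡ 2.
  byThird : ∀ {u b} → Mod3 u → Mod3 b → Removable b (+ 3 * u - + 1 - b) ⊎ OnLine b (+ 3 * u - + 1 - b)
  byThird {b = b} (mod2 v) _ = replace (v ∷ b ∷ []) v₁ (‵ 3 :* (‵ 3 :* v₀ :- ‵ 1) :- ‵ 1 :- v₁)
    (‵ 4 :* v₀ :- ‵ 2) (v₁ :- ‵ 8 :* v₀ :+ ‵ 4) (v₀ :- v₁)
    (# 6) (# 7) (# 8) (+ 9) refl refl refl refl
  byThird {b = b} (mod1 v) _ = replace (v ∷ b ∷ []) v₁ (‵ 3 :* (‵ 3 :* v₀ :+ ‵ 1) :- ‵ 1 :- v₁)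
    (:- (‵ 4 :* v₀)) (‵ 8 :* v₀ :- v₁ :+ ‵ 2) (v₁ :- v₀)
    (# 9) (# 10) (# 11) (+ 9) refl refl refl refl
  byThird (mod0 v) (mod1 β) = replace (v ∷ β ∷ []) (‵ 3 :* v₁ :+ ‵ 1) (‵ 3 :* (‵ 3 :* v₀) :- ‵ 1 :- (‵ 3 :* v₁ :+ ‵ 1))
    (‵ 4 :* v₁ :- ‵ 4 :* v₀ :+ ‵ 2) (v₁ :- ‵ 4 :* v₀ :+ ‵ 1) (v₁ :- ‵ 7 :* v₀ :+ ‵ 2)
    (# 12) (# 13) (# 14) (+ 9) refl refl refl refl
  byThird (mod0 v) (mod0 β) = replace (v ∷ β ∷ []) (‵ 3 :* v₁) (‵ 3 :* (‵ 3 :* v₀) :- ‵ 1 :- ‵ 3 :* v₁)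
    (‵ 4 :* v₀ :- ‵ 4 :* v₁) (‵ 4 :* v₀ :- v₁) (‵ 7 :* v₀ :- v₁ :- ‵ 1)
    (# 15) (# 16) (# 17) (+ 9) refl refl refl refl
  byThird (mod0 v) (mod2 β) = replace (v ∷ β ∷ []) (‵ 3 :* v₁ :- ‵ 1) (‵ 3 :* (‵ 3 :* v₀) :- ‵ 1 :- (‵ 3 :* v₁ :- ‵ 1))
    (‵ 4 :* v₁ :- ‵ 8 :* v₀) (‵ 4 :* v₀ :+ v₁ :- ‵ 1) (v₀ :+ v₁)
    (# 18) (# 19) (# 20) (+ 9) refl refl refl refl

removable⊎onLine : ∀ b c → Removable b c ⊎ OnLine b c
removable⊎onLine b c = subst (λ c → Removable b c ⊎ OnLine b c) (cancel b c) (bySumResidue b (mod3 (b + c)))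
  where
  cancel : ∀ b c → b + c - b ≡ c
  cancel = solve-∀

-- The finitely many intersections of three bad lines

record Quadruple : Set where
  constructor ⟨_,_,_,_⟩
  field
    y₁ y₂ y₃ y₄ : ℕ

-- The x with y = ∣ 1 - 3x ∣, for y prime to 3.
root : ℕ → ℤ
root y = if y ℕ.% 3 ℕ.≡ᵇ 2 then + suc (y ℕ./ 3) else - + (y ℕ./ 3)

total : Quadruple → ℤ
total ⟨ a , b , c , d ⟩ = P₈ (root a) + (P₈ (root b) + (P₈ (root c) + (P₈ (root d) + + 0)))

nonrepresentable : List ℕ
nonrepresentable = 0 ∷ 1 ∷ 2 ∷ 3 ∷ map (4 ℕ.+_) exceptionalOffsets

-- Entries are the numbers |1 - 3x|, all at least 2, so that no x is 0. The quadruples serve the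
-- values outside `nonrepresentable` that occur at integral points in `pinned₃`, `pinned₂` and
-- `pinned₁`.
representations : List Quadruple
representations =
  ⟨ 2 , 2 , 2 , 4 ⟩ ∷ ⟨ 2 , 4 , 4 , 4 ⟩ ∷ ⟨ 2 , 2 , 5 , 5 ⟩ ∷ ⟨ 2 , 4 , 5 , 5 ⟩ ∷ ⟨ 2 , 2 , 2 , 8 ⟩ ∷
  ⟨ 2 , 5 , 5 , 5 ⟩ ∷ ⟨ 4 , 5 , 5 , 5 ⟩ ∷ ⟨ 2 , 4 , 4 , 8 ⟩ ∷ ⟨ 2 , 2 , 7 , 7 ⟩ ∷ ⟨ 4 , 5 , 5 , 7 ⟩ ∷
  ⟨ 4 , 4 , 7 , 7 ⟩ ∷ ⟨ 4 , 5 , 7 , 7 ⟩ ∷ ⟨ 2 , 5 , 7 , 8 ⟩ ∷ ⟨ 2 , 7 , 7 , 7 ⟩ ∷ ⟨ 2 , 2 , 8 , 10 ⟩ ∷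
  ⟨ 2 , 5 , 5 , 11 ⟩ ∷ ⟨ 2 , 2 , 2 , 13 ⟩ ∷ ⟨ 4 , 5 , 5 , 11 ⟩ ∷ ⟨ 2 , 4 , 7 , 11 ⟩ ∷
  ⟨ 2 , 8 , 8 , 8 ⟩ ∷ ⟨ 4 , 5 , 7 , 11 ⟩ ∷ ⟨ 2 , 2 , 4 , 14 ⟩ ∷ ⟨ 4 , 5 , 5 , 13 ⟩ ∷
  ⟨ 2 , 5 , 7 , 13 ⟩ ∷ ⟨ 2 , 7 , 8 , 13 ⟩ ∷ ⟨ 2 , 4 , 8 , 16 ⟩ ∷ ⟨ 2 , 2 , 8 , 17 ⟩ ∷
  ⟨ 2 , 7 , 11 , 14 ⟩ ∷ ⟨ 4 , 7 , 7 , 17 ⟩ ∷ ⟨ 2 , 2 , 2 , 20 ⟩ ∷ ⟨ 4 , 5 , 5 , 19 ⟩ ∷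
  ⟨ 2 , 4 , 4 , 20 ⟩ ∷ ⟨ 4 , 7 , 7 , 19 ⟩ ∷ ⟨ 2 , 4 , 13 , 17 ⟩ ∷ ⟨ 2 , 5 , 13 , 17 ⟩ ∷
  ⟨ 2 , 8 , 16 , 16 ⟩ ∷ ⟨ 2 , 5 , 11 , 22 ⟩ ∷ ⟨ 4 , 11 , 13 , 19 ⟩ ∷ ⟨ 2 , 5 , 19 , 19 ⟩ ∷
  ⟨ 2 , 7 , 7 , 26 ⟩ ∷ ⟨ 2 , 2 , 17 , 23 ⟩ ∷ ⟨ 2 , 5 , 14 , 25 ⟩ ∷ ⟨ 2 , 5 , 5 , 29 ⟩ ∷
  ⟨ 2 , 5 , 11 , 29 ⟩ ∷ ⟨ 2 , 5 , 22 , 23 ⟩ ∷ ⟨ 2 , 7 , 10 , 31 ⟩ ∷ ⟨ 2 , 7 , 19 , 29 ⟩ ∷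
  ⟨ 2 , 2 , 22 , 28 ⟩ ∷ ⟨ 4 , 5 , 7 , 35 ⟩ ∷ ⟨ 4 , 5 , 23 , 29 ⟩ ∷ ⟨ 2 , 2 , 16 , 34 ⟩ ∷
  ⟨ 2 , 7 , 7 , 37 ⟩ ∷ ⟨ 4 , 5 , 25 , 29 ⟩ ∷ ⟨ 2 , 16 , 23 , 29 ⟩ ∷ ⟨ 4 , 11 , 13 , 37 ⟩ ∷
  ⟨ 2 , 4 , 8 , 40 ⟩ ∷ ⟨ 4 , 5 , 5 , 41 ⟩ ∷ ⟨ 2 , 14 , 20 , 34 ⟩ ∷ ⟨ 2 , 4 , 8 , 44 ⟩ ∷
  ⟨ 2 , 2 , 22 , 40 ⟩ ∷ ⟨ 2 , 8 , 16 , 44 ⟩ ∷ ⟨ 4 , 5 , 5 , 47 ⟩ ∷ ⟨ 2 , 7 , 7 , 47 ⟩ ∷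
  ⟨ 2 , 4 , 20 , 44 ⟩ ∷ ⟨ 2 , 2 , 32 , 38 ⟩ ∷ ⟨ 2 , 2 , 26 , 44 ⟩ ∷ ⟨ 2 , 8 , 26 , 46 ⟩ ∷
  ⟨ 2 , 16 , 20 , 52 ⟩ ∷ ⟨ 2 , 11 , 19 , 55 ⟩ ∷ ⟨ 2 , 4 , 14 , 58 ⟩ ∷ ⟨ 2 , 5 , 35 , 49 ⟩ ∷
  ⟨ 2 , 4 , 44 , 44 ⟩ ∷ ⟨ 2 , 4 , 28 , 56 ⟩ ∷ ⟨ 4 , 7 , 25 , 59 ⟩ ∷ ⟨ 2 , 16 , 16 , 64 ⟩ ∷
  ⟨ 4 , 7 , 49 , 49 ⟩ ∷ ⟨ 4 , 4 , 50 , 52 ⟩ ∷ ⟨ 2 , 2 , 16 , 74 ⟩ ∷ ⟨ 4 , 7 , 7 , 79 ⟩ ∷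
  ⟨ 2 , 5 , 53 , 62 ⟩ ∷ ⟨ 4 , 5 , 17 , 83 ⟩ ∷ ⟨ 2 , 10 , 50 , 76 ⟩ ∷ ⟨ 2 , 5 , 13 , 103 ⟩ ∷
  ⟨ 4 , 4 , 20 , 110 ⟩ ∷ ⟨ 4 , 5 , 5 , 113 ⟩ ∷ ⟨ 2 , 2 , 46 , 104 ⟩ ∷ ⟨ 4 , 4 , 82 , 92 ⟩ ∷
  ⟨ 4 , 5 , 55 , 121 ⟩ ∷ ⟨ 4 , 7 , 17 , 151 ⟩ ∷ ⟨ 2 , 4 , 44 , 148 ⟩ ∷ ⟨ 2 , 8 , 10 , 194 ⟩ ∷
  ⟨ 4 , 13 , 73 , 185 ⟩ ∷ ⟨ 2 , 2 , 116 , 170 ⟩ ∷ ⟨ 2 , 2 , 134 , 164 ⟩ ∷ ⟨ 2 , 2 , 10 , 212 ⟩ ∷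
  ⟨ 2 , 7 , 13 , 253 ⟩ ∷ ⟨ 2 , 13 , 235 , 253 ⟩ ∷ []

Listed : ℤ → ℤ → Set
Listed n v = Any (λ r → + r * n ≡ v) nonrepresentable ⊎ Any (λ t → total t * n ≡ v) representations

-- Cramer's rule for l₁ at b , c ≡ l₂ at b , d ≡ l₃ at c , d ≡ 0.
module Cramer (l₁ l₂ l₃ : Line) where
  open Line l₁ renaming (p to p₁; q to q₁; r to r₁)
  open Line l₂ renaming (p to p₂; q to q₂; r to r₂)
  open Line l₃ renaming (p to p₃; q to q₃; r to r₃)

  Δ B C D V : ℤ
  -- `Δ` is minus the determinant of the system. `V` is Δ² times the sum of `P₈` over the solution
  -- (B/Δ , C/Δ , D/Δ), with denominators cleared.
  Δ = p₁ * q₂ * p₃ + q₁ * p₂ * q₃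
  B = q₁ * q₂ * r₃ - p₃ * q₂ * r₁ - q₁ * q₃ * r₂
  C = p₁ * q₃ * r₂ - p₁ * q₂ * r₃ - p₂ * q₃ * r₁
  D = p₂ * p₃ * r₁ - p₁ * p₃ * r₂ - p₂ * q₁ * r₃
  V = (+ 3 * B - + 2 * Δ) * B + (+ 3 * C - + 2 * Δ) * C + (+ 3 * D - + 2 * Δ) * D

  Pinned : Set
  Pinned = Δ ≢ + 0 × (¬ (Δ ∣ℤ B) ⊎ ¬ (Δ ∣ℤ C) ⊎ ¬ (Δ ∣ℤ D) ⊎ Listed (Δ * Δ) V)

  pinned? : Dec Pinned
  pinned? = ¬? (Δ ℤ.≟ + 0) ×-dec
    (¬? (∣ Δ ∣ ∣? ∣ B ∣) ⊎-dec ¬? (∣ Δ ∣ ∣? ∣ C ∣) ⊎-dec ¬? (∣ Δ ∣ ∣? ∣ D ∣) ⊎-dec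
     any? (λ r → + r * (Δ * Δ) ℤ.≟ V) nonrepresentable ⊎-dec
     any? (λ t → total t * (Δ * Δ) ℤ.≟ V) representations)

-- Decided by evaluating all 21³ systems: each has a single rational solution, which is either not
-- integral or has a listed value.
pinned₃ : ∀ i j k → Cramer.Pinned (lookup badLines i) (lookup badLines j) (lookup badLines k)
pinned₃ = from-yes (Fin.all? λ i → Fin.all? λ j → Fin.all? λ k → Cramer.pinned? (lookup badLines i) (lookup badLines j) (lookup badLines k))

-- When b = 0 the equation b = 0 and a line through (0 , c), now read as one on (c , d), complete
-- the system of `Cramer`.
axis : Line
axis = line (+ 1) (+ 0) (+ 0)

restrict : Line → Line
restrict (line p q r) = line q (+ 0) r

pinned₂ : ∀ i j → Cramer.Pinned axis (lookup badLines i) (restrict (lookup badLines j))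
pinned₂ = from-yes (Fin.all? λ i → Fin.all? λ j → Cramer.pinned? axis (lookup badLines i) (restrict (lookup badLines j)))

pinned₁ : ∀ i → Cramer.Pinned axis (lookup badLines i) axis
pinned₁ = from-yes (Fin.all? λ i → Cramer.pinned? axis (lookup badLines i) axis)

P₈≢0 : ∀ {x} → x ≢ + 0 → P₈ x ≢ + 0
P₈≢0 {x} x≢0 e = [ x≢0 , (λ z → 3∤ (from-no (3 ∣? 2)) x (cong ∣_∣ (ℤ.i-j≡0⇒i≡j (+ 3 * x) (+ 2) z))) ]′
  (ℤ.i*j≡0⇒i≡0∨j≡0 x (trans (factor x) e))
  where
  factor : ∀ x → x * (+ 3 * x - + 2) ≡ P₈ x
  factor = solve 1 (λ x → x :* (con (+ 3) :* x :- con (+ 2)) := :P₈ x) refl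

Outcome : ℕ → Set
Outcome m = m ∈ nonrepresentable ⊎ SumOfNonzeroOct 4 m

four : ∀ {m} x y z w → x ≢ + 0 → y ≢ + 0 → z ≢ + 0 → w ≢ + 0 →
  P₈ x + (P₈ y + (P₈ z + (P₈ w + + 0))) ≡ + m → Outcome m
four x y z w x≢0 y≢0 z≢0 w≢0 e =
  inj₂ (x ∷ y ∷ z ∷ w ∷ [] , P₈≢0 x≢0 ∷ P₈≢0 y≢0 ∷ P₈≢0 z≢0 ∷ P₈≢0 w≢0 ∷ [] , e)

rootsNonzero : All (λ (⟨ a , b , c , d ⟩) → root a ≢ + 0 × root b ≢ + 0 × root c ≢ + 0 × root d ≢ + 0) representations
rootsNonzero = from-yes (All.all? (λ (⟨ a , b , c , d ⟩) →
  ¬? (root a ℤ.≟ + 0) ×-dec ¬? (root b ℤ.≟ + 0) ×-dec ¬? (root c ℤ.≟ + 0) ×-dec ¬? (root d ℤ.≟ + 0)) representations)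

listed⇒outcome : ∀ m n v → n ≢ + 0 → + m * n ≡ v → Listed n v → Outcome m
listed⇒outcome m n v n≢0 e (inj₁ small) =
  inj₁ (Any.map (λ {r} e′ → sym (ℤ.+-injective (ℤ.*-cancelʳ-≡ (+ r) (+ m) n {{ℤ.≢-nonZero n≢0}} (trans e′ (sym e))))) small)
listed⇒outcome m n v n≢0 e (inj₂ found) = represent (find found)
  where
  represent : ∃ (λ t → t ∈ representations × total t * n ≡ v) → Outcome m
  represent (t@(⟨ a , b , c , d ⟩) , t∈ , e′) = quadruple (All.lookup rootsNonzero t∈)
    where
    quadruple : root a ≢ + 0 × root b ≢ + 0 × root c ≢ + 0 × root d ≢ + 0 → Outcome m
    quadruple (a≢0 , b≢0 , c≢0 , d≢0) = four (root a) (root b) (root c) (root d) a≢0 b≢0 c≢0 d≢0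
      (ℤ.*-cancelʳ-≡ (total t) (+ m) n {{ℤ.≢-nonZero n≢0}} (trans e′ (sym e)))

module CramerSound (l₁ l₂ l₃ : Line) (b c d : ℤ) (m : ℕ)
  (e₁ : l₁ at b , c ≡ + 0) (e₂ : l₂ at b , d ≡ + 0) (e₃ : l₃ at c , d ≡ + 0)
  (sum≡ : P₈ b + (P₈ c + (P₈ d + + 0)) ≡ + m) where

  open Cramer l₁ l₂ l₃
  open Line l₁ renaming (p to p₁; q to q₁; r to r₁)
  open Line l₂ renaming (p to p₂; q to q₂; r to r₂)
  open Line l₃ renaming (p to p₃; q to q₃; r to r₃)

  combine : ∀ x y z s {t} → t ≡ s + (x * (l₁ at b , c) + y * (l₂ at b , d) + z * (l₃ at c , d)) → t ≡ s
  combine x y z s e = trans e (trans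
    (cong (λ i → s + i) (cong₂ _+_ (cong₂ _+_ (vanish x e₁) (vanish y e₂)) (vanish z e₃)))
    (ℤ.+-identityʳ s))
    where
    vanish : ∀ x {i} → i ≡ + 0 → x * i ≡ + 0
    vanish x refl = ℤ.*-zeroʳ x

  -- Here and for c and d, the coefficients given to `combine` are the negated cofactors in the
  -- column of the unknown.
  Δb≡B : Δ * b ≡ B
  Δb≡B = combine (p₃ * q₂) (q₁ * q₃) (- (q₁ * q₂)) B (identity p₁ q₁ r₁ p₂ q₂ r₂ p₃ q₃ r₃ b c d)
    where
    identity : ∀ p₁ q₁ r₁ p₂ q₂ r₂ p₃ q₃ r₃ b c d → (p₁ * q₂ * p₃ + q₁ * p₂ * q₃) * b ≡
      q₁ * q₂ * r₃ - p₃ * q₂ * r₁ - q₁ * q₃ * r₂ + (p₃ * q₂ * (p₁ * b + q₁ * c + r₁) +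
      q₁ * q₃ * (p₂ * b + q₂ * d + r₂) + - (q₁ * q₂) * (p₃ * c + q₃ * d + r₃))
    identity = solve-∀

  Δc≡C : Δ * c ≡ C
  Δc≡C = combine (p₂ * q₃) (- (p₁ * q₃)) (p₁ * q₂) C (identity p₁ q₁ r₁ p₂ q₂ r₂ p₃ q₃ r₃ b c d)
    where
    identity : ∀ p₁ q₁ r₁ p₂ q₂ r₂ p₃ q₃ r₃ b c d → (p₁ * q₂ * p₃ + q₁ * p₂ * q₃) * c ≡
      p₁ * q₃ * r₂ - p₁ * q₂ * r₃ - p₂ * q₃ * r₁ + (p₂ * q₃ * (p₁ * b + q₁ * c + r₁) +
      - (p₁ * q₃) * (p₂ * b + q₂ * d + r₂) + p₁ * q₂ * (p₃ * c + q₃ * d + r₃))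
    identity = solve-∀

  Δd≡D : Δ * d ≡ D
  Δd≡D = combine (- (p₂ * p₃)) (p₁ * p₃) (p₂ * q₁) D (identity p₁ q₁ r₁ p₂ q₂ r₂ p₃ q₃ r₃ b c d)
    where
    identity : ∀ p₁ q₁ r₁ p₂ q₂ r₂ p₃ q₃ r₃ b c d → (p₁ * q₂ * p₃ + q₁ * p₂ * q₃) * d ≡
      p₂ * p₃ * r₁ - p₁ * p₃ * r₂ - p₂ * q₁ * r₃ + (- (p₂ * p₃) * (p₁ * b + q₁ * c + r₁) +
      p₁ * p₃ * (p₂ * b + q₂ * d + r₂) + p₂ * q₁ * (p₃ * c + q₃ * d + r₃))
    identity = solve-∀

  Δ∣ : ∀ {x X} → Δ * x ≡ X → Δ ∣ℤ X
  Δ∣ {x} e = divides ∣ x ∣ (trans (cong ∣_∣ (sym e)) (trans (ℤ.abs-* Δ x) (ℕ.*-comm ∣ Δ ∣ ∣ x ∣)))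

  mΔ²≡V : + m * (Δ * Δ) ≡ V
  mΔ²≡V = begin
    + m * (Δ * Δ)                                     ≡⟨ cong (_* (Δ * Δ)) sum≡ ⟨
    (P₈ b + (P₈ c + (P₈ d + + 0))) * (Δ * Δ)          ≡⟨ scale Δ b c d ⟩
    term (Δ * b) + term (Δ * c) + term (Δ * d)        ≡⟨ cong₂ _+_ (cong₂ _+_ (cong term Δb≡B) (cong term Δc≡C)) (cong term Δd≡D) ⟩
    V                                                 ∎
    where
    open ≡-Reasoning
    term : ℤ → ℤ
    term x = (+ 3 * x - + 2 * Δ) * x
    scale : ∀ Δ b c d → (P₈ b + (P₈ c + (P₈ d + + 0))) * (Δ * Δ) ≡
      (+ 3 * (Δ * b) - + 2 * Δ) * (Δ * b) + (+ 3 * (Δ * c) - + 2 * Δ) * (Δ * c) + (+ 3 * (Δ * d) - + 2 * Δ) * (Δ * d)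
    scale = solve 4 (λ Δ b c d → let term = λ x → (con (+ 3) :* x :- con (+ 2) :* Δ) :* x in
      (:P₈ b :+ (:P₈ c :+ (:P₈ d :+ con (+ 0)))) :* (Δ :* Δ) := term (Δ :* b) :+ term (Δ :* c) :+ term (Δ :* d)) refl

  outcome : Pinned → Outcome m
  outcome (_   , inj₁ Δ∤B)               = contradiction (Δ∣ {b} Δb≡B) Δ∤B
  outcome (_   , inj₂ (inj₁ Δ∤C))        = contradiction (Δ∣ {c} Δc≡C) Δ∤C
  outcome (_   , inj₂ (inj₂ (inj₁ Δ∤D))) = contradiction (Δ∣ {d} Δd≡D) Δ∤D
  outcome (Δ≢0 , inj₂ (inj₂ (inj₂ l)))   = listed⇒outcome m (Δ * Δ) V
    (λ e → Δ≢0 (i*i≡0⇒i≡0 {Δ} e)) mΔ²≡V l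

-- Removing zeros from a sum of four octagonal numbers

assoc₄ : ∀ p q r s → p + (q + (r + (s + + 0))) ≡ p + q + r + s
assoc₄ = solve-∀

insert : ∀ {m} i j k → Removable i j → k ≢ + 0 → P₈ i + P₈ j + P₈ k ≡ + m → Outcome m
insert i j k (x , y , z , (x≢0 , y≢0 , z≢0) , e′) k≢0 e = four x y z k x≢0 y≢0 z≢0 k≢0
  (trans (assoc₄ (P₈ x) (P₈ y) (P₈ z) (P₈ k)) (trans (cong (_+ P₈ k) e′) e))

-- The zero is joined with each pair in turn, and the coordinate left over becomes the fourth term.
-- If all three pairs fail, `pinned₃` applies to (b , c , d).
oneZero : ∀ {m} b c d → b ≢ + 0 → c ≢ + 0 → d ≢ + 0 → P₈ b + (P₈ c + (P₈ d + + 0)) ≡ + m → Outcome m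
oneZero {m} b c d b≢0 c≢0 d≢0 e = first (removable⊎onLine b c)
  where
  unassoc : ∀ p q r → p + q + r ≡ p + (q + (r + + 0))
  unassoc = solve-∀
  third : OnLine b c → OnLine b d → Removable c d ⊎ OnLine c d → Outcome m
  third _ _ (inj₁ r) = insert c d b r b≢0 (trans (rotate (P₈ c) (P₈ d) (P₈ b)) e)
    where
    rotate : ∀ p q r → p + q + r ≡ r + (p + (q + + 0))
    rotate = solve-∀
  third (i , e₁) (j , e₂) (inj₂ (k , e₃)) =
    CramerSound.outcome (lookup badLines i) (lookup badLines j) (lookup badLines k) b c d m e₁ e₂ e₃ e (pinned₃ i j k)
  second : OnLine b c → Removable b d ⊎ OnLine b d → Outcome m
  second _ (inj₁ r) = insert b d c r c≢0 (trans (swap (P₈ b) (P₈ d) (P₈ c)) e)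
    where
    swap : ∀ p q r → p + q + r ≡ p + (r + (q + + 0))
    swap = solve-∀
  second l₁ (inj₂ l₂) = third l₁ l₂ (removable⊎onLine c d)
  first : Removable b c ⊎ OnLine b c → Outcome m
  first (inj₁ r) = insert b c d r d≢0 (trans (unassoc (P₈ b) (P₈ c) (P₈ d)) e)
  first (inj₂ l) = second l (removable⊎onLine b d)

-- Both zeros are used at once: replacing (0 , 0 , c) leaves d, and replacing (0 , 0 , d) leaves c.
-- If both fail, one line fixes c and another fixes d.
twoZeros : ∀ {m} c d → c ≢ + 0 → d ≢ + 0 → P₈ c + (P₈ d + + 0) ≡ + m → Outcome m
twoZeros {m} c d c≢0 d≢0 e = first (removable⊎onLine (+ 0) c)
  where
  shift : ∀ p q r c d → q * c + + 0 * d + r ≡ p * + 0 + q * c + r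
  shift = solve-∀
  second : OnLine (+ 0) c → Removable (+ 0) d ⊎ OnLine (+ 0) d → Outcome m
  second _ (inj₁ r) = insert (+ 0) d c r c≢0 (trans (swap (P₈ d) (P₈ c)) e)
    where
    swap : ∀ q r → + 0 + q + r ≡ r + (q + + 0)
    swap = solve-∀
  second (i , e₁) (inj₂ (j , e₂)) =
    CramerSound.outcome axis (lookup badLines j) (restrict (lookup badLines i)) (+ 0) c d m refl e₂
      (trans (shift (Line.p (lookup badLines i)) (Line.q (lookup badLines i)) (Line.r (lookup badLines i)) c d) e₁)
      (trans (ℤ.+-identityˡ (P₈ c + (P₈ d + + 0))) e) (pinned₂ j i)
  first : Removable (+ 0) c ⊎ OnLine (+ 0) c → Outcome m
  first (inj₁ r) = insert (+ 0) c d r d≢0 (trans (unassoc (P₈ c) (P₈ d)) e)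
    where
    unassoc : ∀ q r → + 0 + q + r ≡ q + (r + + 0)
    unassoc = solve-∀
  first (inj₂ l) = second l (removable⊎onLine (+ 0) d)

-- Replacing (0 , 0 , d) still leaves the fourth coordinate 0, so `oneZero` has to finish.
threeZeros : ∀ {m} d → d ≢ + 0 → P₈ d + + 0 ≡ + m → Outcome m
threeZeros {m} d d≢0 e = first (removable⊎onLine (+ 0) d)
  where
  first : Removable (+ 0) d ⊎ OnLine (+ 0) d → Outcome m
  first (inj₁ (x , y , z , (x≢0 , y≢0 , z≢0) , e′)) = oneZero x y z x≢0 y≢0 z≢0
    (trans (assoc (P₈ x) (P₈ y) (P₈ z)) (trans e′ (trans (ℤ.+-comm (+ 0) (P₈ d)) e)))
    where
    assoc : ∀ p q r → p + (q + (r + + 0)) ≡ p + q + r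
    assoc = solve-∀
  first (inj₂ (i , e₁)) = CramerSound.outcome axis (lookup badLines i) axis (+ 0) (+ 0) d m refl e₁ refl
    (trans (ℤ.+-identityˡ (+ 0 + (P₈ d + + 0))) (trans (ℤ.+-identityˡ (P₈ d + + 0)) e)) (pinned₁ i)

sumList : List ℤ → ℤ
sumList = List.foldr (λ x s → P₈ x + s) (+ 0)

dropZeros : ∀ xs → ∃ λ ys → All (_≢ + 0) ys × length ys ℕ.≤ length xs × sumList ys ≡ sumList xs
dropZeros []       = [] , [] , z≤n , refl
dropZeros (x ∷ xs) with x ℤ.≟ + 0 | dropZeros xs
... | yes refl | ys , nz , l , e = ys , nz , ℕ.m≤n⇒m≤1+n l , trans e (sym (ℤ.+-identityˡ (sumList xs)))
... | no x≢0   | ys , nz , l , e = x ∷ ys , x≢0 ∷ nz , s≤s l , cong (λ s → P₈ x + s) e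

outcome : ∀ m → Outcome m
outcome m = start (fourOctagonals m)
  where
  cases : ∀ ys → All (_≢ + 0) ys → length ys ℕ.≤ 4 → sumList ys ≡ + m → Outcome m
  cases [] _ _ e = inj₁ (here (sym (ℤ.+-injective e)))
  cases (d ∷ []) (pd ∷ _) _ e = threeZeros d pd e
  cases (c ∷ d ∷ []) (pc ∷ pd ∷ _) _ e = twoZeros c d pc pd e
  cases (b ∷ c ∷ d ∷ []) (pb ∷ pc ∷ pd ∷ _) _ e = oneZero b c d pb pc pd e
  cases (a ∷ b ∷ c ∷ d ∷ []) (pa ∷ pb ∷ pc ∷ pd ∷ _) _ e = four a b c d pa pb pc pd e
  cases (_ ∷ _ ∷ _ ∷ _ ∷ _ ∷ _) _ (s≤s (s≤s (s≤s (s≤s ())))) _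
  start : (∃ λ x → ∃ λ y → ∃ λ z → ∃ λ w → P₈ x + P₈ y + P₈ z + P₈ w ≡ + m) → Outcome m
  start (x , y , z , w , e) = drop (dropZeros (x ∷ y ∷ z ∷ w ∷ []))
    where
    drop : (∃ λ ys → All (_≢ + 0) ys × length ys ℕ.≤ 4 × sumList ys ≡ sumList (x ∷ y ∷ z ∷ w ∷ [])) → Outcome m
    drop (ys , nz , l , e′) = cases ys nz l (trans e′ (trans (assoc₄ (P₈ x) (P₈ y) (P₈ z) (P₈ w)) e))

-- The semigroup generated by 4 and 7

pos-quadratic : ∀ a b c h → + (a ℕ.* (h ℕ.* h) ℕ.+ b ℕ.* h ℕ.+ c) ≡ + a * (+ h * + h) + + b * + h + + c
pos-quadratic a b c h = cong₂ (λ s t → s + t + + c)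
  (trans (ℤ.pos-* a (h ℕ.* h)) (cong (λ s → + a * s) (ℤ.pos-* h h))) (ℤ.pos-* b h)

-- For odd x, P₈ x - 1 = (x - 1)(3x + 1) is a multiple of 4; for even x, so is P₈ x - 8 = (x - 2)(3x
-- + 4). Both are nonnegative when x ≠ 0 has that parity, so j is 0 or 1.
P₈-semigroup : ∀ x → P₈ x ≢ + 0 → ∃ λ i → ∃ λ j → P₈ x ≡ + 1 + (+ 4 * + i + + 7 * + j)
P₈-semigroup (+ zero) ≢0 = contradiction refl ≢0
P₈-semigroup (+ suc n) _ = byHalf (half n)
  where
  byHalf : (∃ λ h → n ≡ h ℕ.+ h ⊎ n ≡ suc (h ℕ.+ h)) → ∃ λ i → ∃ λ j → P₈ (+ suc n) ≡ + 1 + (+ 4 * + i + + 7 * + j)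
  byHalf (h , inj₁ refl) = 3 ℕ.* (h ℕ.* h) ℕ.+ 2 ℕ.* h ℕ.+ 0 , 0 ,
    trans (identity (+ h)) (cong (λ s → + 1 + (+ 4 * s + + 0)) (sym (pos-quadratic 3 2 0 h)))
    where
    identity : ∀ h → P₈ (+ 1 + (h + h)) ≡ + 1 + (+ 4 * (+ 3 * (h * h) + + 2 * h + + 0) + + 0)
    identity = solve 1 (λ h → :P₈ (con (+ 1) :+ (h :+ h)) :=
      con (+ 1) :+ (con (+ 4) :* (con (+ 3) :* (h :* h) :+ con (+ 2) :* h :+ con (+ 0)) :+ con (+ 0))) refl
  byHalf (h , inj₂ refl) = 3 ℕ.* (h ℕ.* h) ℕ.+ 5 ℕ.* h ℕ.+ 0 , 1 ,
    trans (identity (+ h)) (cong (λ s → + 1 + (+ 4 * s + + 7)) (sym (pos-quadratic 3 5 0 h)))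
    where
    identity : ∀ h → P₈ (+ 2 + (h + h)) ≡ + 1 + (+ 4 * (+ 3 * (h * h) + + 5 * h + + 0) + + 7)
    identity = solve 1 (λ h → :P₈ (con (+ 2) :+ (h :+ h)) :=
      con (+ 1) :+ (con (+ 4) :* (con (+ 3) :* (h :* h) :+ con (+ 5) :* h :+ con (+ 0)) :+ con (+ 7))) refl
P₈-semigroup -[1+ n ] _ = byHalf (half n)
  where
  byHalf : (∃ λ h → n ≡ h ℕ.+ h ⊎ n ≡ suc (h ℕ.+ h)) → ∃ λ i → ∃ λ j → P₈ -[1+ n ] ≡ + 1 + (+ 4 * + i + + 7 * + j)
  byHalf (h , inj₁ refl) = 3 ℕ.* (h ℕ.* h) ℕ.+ 4 ℕ.* h ℕ.+ 1 , 0 ,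
    trans (identity (+ h)) (cong (λ s → + 1 + (+ 4 * s + + 0)) (sym (pos-quadratic 3 4 1 h)))
    where
    identity : ∀ h → P₈ (- (+ 1 + (h + h))) ≡ + 1 + (+ 4 * (+ 3 * (h * h) + + 4 * h + + 1) + + 0)
    identity = solve 1 (λ h → :P₈ (:- (con (+ 1) :+ (h :+ h))) :=
      con (+ 1) :+ (con (+ 4) :* (con (+ 3) :* (h :* h) :+ con (+ 4) :* h :+ con (+ 1)) :+ con (+ 0))) refl
  byHalf (h , inj₂ refl) = 3 ℕ.* (h ℕ.* h) ℕ.+ 7 ℕ.* h ℕ.+ 2 , 1 ,
    trans (identity (+ h)) (cong (λ s → + 1 + (+ 4 * s + + 7)) (sym (pos-quadratic 3 7 2 h)))
    where
    identity : ∀ h → P₈ (- (+ 2 + (h + h))) ≡ + 1 + (+ 4 * (+ 3 * (h * h) + + 7 * h + + 2) + + 7)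
    identity = solve 1 (λ h → :P₈ (:- (con (+ 2) :+ (h :+ h))) :=
      con (+ 1) :+ (con (+ 4) :* (con (+ 3) :* (h :* h) :+ con (+ 7) :* h :+ con (+ 2)) :+ con (+ 7))) refl

sumP₈-semigroup : ∀ {k} (xs : Vec ℤ k) → VecAll.All (λ x → P₈ x ≢ + 0) xs →
  ∃ λ i → ∃ λ j → sumP₈ xs ≡ + k + (+ 4 * + i + + 7 * + j)
sumP₈-semigroup [] [] = 0 , 0 , refl
sumP₈-semigroup {suc k} (x ∷ xs) (px ∷ pxs) = add (P₈-semigroup x px) (sumP₈-semigroup xs pxs)
  where
  regroup : ∀ k i j i′ j′ → + 1 + (+ 4 * i + + 7 * j) + (k + (+ 4 * i′ + + 7 * j′)) ≡
    + 1 + k + (+ 4 * (i + i′) + + 7 * (j + j′))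
  regroup = solve-∀
  add : (∃ λ i → ∃ λ j → P₈ x ≡ + 1 + (+ 4 * + i + + 7 * + j)) →
        (∃ λ i → ∃ λ j → sumP₈ xs ≡ + k + (+ 4 * + i + + 7 * + j)) →
        ∃ λ i → ∃ λ j → P₈ x + sumP₈ xs ≡ + suc k + (+ 4 * + i + + 7 * + j)
  add (i , j , e) (i′ , j′ , e′) = i ℕ.+ i′ , j ℕ.+ j′ , trans (cong₂ _+_ e e′) (regroup (+ k) (+ i) (+ j) (+ i′) (+ j′))

-- The largest gap is 4 · 7 - 4 - 7 = 17, and b = 4i + 7j bounds i and j by b, so a search below 18
-- is exhaustive.
gaps : All (λ b → b ℕ.< 18 × ∀ (i j : Fin 18) → b ≢ 4 ℕ.* toℕ i ℕ.+ 7 ℕ.* toℕ j) exceptionalOffsets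
gaps = from-yes (All.all? (λ b → b ℕ.<? 18 ×-dec
  Fin.all? λ (i : Fin 18) → Fin.all? λ (j : Fin 18) → ¬? (b ℕ.≟ 4 ℕ.* toℕ i ℕ.+ 7 ℕ.* toℕ j)) exceptionalOffsets)

gap≢ : ∀ {b} → b ∈ exceptionalOffsets → ∀ i j → b ≢ 4 ℕ.* i ℕ.+ 7 ℕ.* j
gap≢ {b} b∈ i j e = refute (All.lookup gaps b∈)
  where
  refute : (b ℕ.< 18 × ∀ (i j : Fin 18) → b ≢ 4 ℕ.* toℕ i ℕ.+ 7 ℕ.* toℕ j) → ⊥
  refute (b<18 , b≢) = b≢ (fromℕ< i<18) (fromℕ< j<18)
    (trans e (sym (cong₂ (λ i j → 4 ℕ.* i ℕ.+ 7 ℕ.* j) (Fin.toℕ-fromℕ< i<18) (Fin.toℕ-fromℕ< j<18))))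
    where
    i<18 : i ℕ.< 18
    i<18 = ℕ.≤-<-trans (ℕ.≤-trans (ℕ.m≤n*m i 4) (ℕ.≤-trans (ℕ.m≤m+n _ _) (ℕ.≤-reflexive (sym e)))) b<18
    j<18 : j ℕ.< 18
    j<18 = ℕ.≤-<-trans (ℕ.≤-trans (ℕ.m≤n*m j 7) (ℕ.≤-trans (ℕ.m≤n+m _ (4 ℕ.* i)) (ℕ.≤-reflexive (sym e)))) b<18

-- The two directions of the equivalence

necessary : ∀ k n → SumOfNonzeroOct k n → ¬ Exceptional k n
necessary k n (xs , nz , e) = refute (sumP₈-semigroup xs nz)
  where
  refute : (∃ λ i → ∃ λ j → sumP₈ xs ≡ + k + (+ 4 * + i + + 7 * + j)) → ¬ Exceptional k n
  refute (i , j , e′) = λ where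
      (inj₁ (_ , n<k))       → ℕ.<⇒≱ n<k (ℕ.≤-trans (ℕ.m≤m+n k _) (ℕ.≤-reflexive (sym n≡)))
      (inj₂ (b , b∈ , n≡k+b)) → gap≢ b∈ i j (ℕ.+-cancelˡ-≡ k b (4 ℕ.* i ℕ.+ 7 ℕ.* j) (trans (sym n≡k+b) n≡))
    where
    n≡ : n ≡ k ℕ.+ (4 ℕ.* i ℕ.+ 7 ℕ.* j)
    n≡ = ℤ.+-injective (trans (sym e) (trans e′ (cong (λ s → + k + s) (sym (cong₂ _+_ (ℤ.pos-* 4 i) (ℤ.pos-* 7 j))))))

pad : ∀ j {k n} → SumOfNonzeroOct k n → SumOfNonzeroOct (j ℕ.+ k) (j ℕ.+ n)
pad zero    s = s
pad (suc j) s = cons (pad j s)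
  where
  cons : ∀ {k n} → SumOfNonzeroOct k n → SumOfNonzeroOct (suc k) (suc n)
  cons (xs , nz , e) = + 1 ∷ xs , (λ ()) ∷ nz , cong (λ s → + 1 + s) e

sufficient : ∀ k → 4 ≤ k → ∀ n → 1 ≤ n → ¬ Exceptional k n → SumOfNonzeroOct k n
sufficient k 4≤k n 1≤n ¬exc = subst₂ SumOfNonzeroOct k≡ n≡ (pad (k ℕ.∸ 4) (represented (outcome (4 ℕ.+ b))))
  where
  k≤n : k ≤ n
  k≤n = ℕ.≮⇒≥ (λ n<k → ¬exc (inj₁ (1≤n , n<k)))
  b = n ℕ.∸ k
  k≡ : k ℕ.∸ 4 ℕ.+ 4 ≡ k
  k≡ = ℕ.m∸n+n≡m 4≤k
  n≡ : k ℕ.∸ 4 ℕ.+ (4 ℕ.+ b) ≡ n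
  n≡ = trans (sym (ℕ.+-assoc (k ℕ.∸ 4) 4 b)) (trans (cong (ℕ._+ b) k≡) (ℕ.m+[n∸m]≡n k≤n))
  offset : 4 ℕ.+ b ∈ map (4 ℕ.+_) exceptionalOffsets → ⊥
  offset p = refute (∈-map⁻ (4 ℕ.+_) p)
    where
    refute : (∃ λ b′ → b′ ∈ exceptionalOffsets × 4 ℕ.+ b ≡ 4 ℕ.+ b′) → ⊥
    refute (b′ , b′∈ , e) = ¬exc (inj₂ (b , subst (_∈ exceptionalOffsets) (sym (ℕ.+-cancelˡ-≡ 4 b b′ e)) b′∈ , sym (ℕ.m+[n∸m]≡n k≤n)))
  represented : Outcome (4 ℕ.+ b) → SumOfNonzeroOct 4 (4 ℕ.+ b)
  represented (inj₂ s) = s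
  represented (inj₁ (there (there (there (there p))))) = ⊥-elim (offset p)
  represented (inj₁ (there (there (there (here ())))))

theorem4p7 : (k : ℕ) → 4 ≤ k → (n : ℕ) → 1 ≤ n →
    SumOfNonzeroOct k n ⇔ (¬ Exceptional k n)
theorem4p7 k 4≤k n 1≤n = mk⇔ (necessary k n) (sufficient k 4≤k n 1≤n)
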